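{- For all well-formed configurations $\mathcal C_1,\mathcal C_2$ of CCCP: if $\mathcal C_1\simeq\mathcal C_2$ (reduction barbed congruence) then $\mathcal C_1\approx\mathcal C_2$ (weak bisimilarity in the extensional labelled transition system).
   Context: The calculus CCCP. Fix a set of channels ranged over by $c,d$, and a set of values containing data variables $x,y$ and a distinguished error value $\mathtt{err}$; every closed value $v$ has a transmission time $\delta_v$, a positive integer. Expressions $e$ are built from values, with an evaluation map $[\![\cdot]\!]$ sending variable-free expressions to closed values; Boolean expressions $b$ are $e_1=e_2$ or $\mathrm{exp}(c)$. Processes: $P,Q ::= c!\langle e\rangle.P \mid \lfloor c?(x).P\rfloor Q \mid \sigma.P \mid \tau.P \mid P+Q \mid [b]P,Q \mid X \mid \mathbf{nil} \mid \mathrm{fix}\,X.P$. System terms: $W ::= P \mid \lceil c?(x).P\rceil \mid W_1\,|\,W_2 \mid \nu c{:}(n,v).W$ ($n\in\mathbb N$, $v$ closed). $x$ is bound in $P$ in both input forms, $X$ in $\mathrm{fix}\,X.P$, $c$ in $\nu c{:}(n,v).W$; terms are up to $\alpha$-conversion. In $\mathrm{fix}\,X.P$ every occurrence of $X$ in $P$ is guarded (inside a broadcast prefix, body or timeout branch of an input, a $\sigma$-prefix, or a matching branch). $\sigma^n.P$ denotes $n$ nested $\sigma$-prefixes. A channel environment $\Gamma$ maps channels to $\mathbb N\times\{\text{closed values}\}$; $\Gamma\vdash_t c:n$, $\Gamma\vdash_v c:w$ mean $\Gamma(c)=(n,w)$; $c$ is idle if $n=0$, exposed otherwise; $\Gamma[c\mapsto(n,v)]$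 is the update at $c$. $\sigma(\Gamma)(c)=(\max(t_c-1,0),v_c)$ where $\Gamma(c)=(t_c,v_c)$; $c!v(\Gamma)$ agrees with $\Gamma$ except at $c$, where it is $(\delta_v,v)$ if $c$ idle in $\Gamma$ and $(\max(\delta_v,t_c),\mathtt{err})$ if exposed; $c?v(\Gamma)=c!v(\Gamma)$; $\tau(\Gamma)=\Gamma$. $[\![e_1=e_2]\!]_\Gamma$ true iff $[\![e_1]\!]=[\![e_2]\!]$; $[\![\mathrm{exp}(c)]\!]_\Gamma$ true iff $c$ exposed in $\Gamma$. $\mathrm{rcv}(W,c)$: true for $\lfloor c?(x).P\rfloor Q$; disjunctive over $+$ and $|$; $\mathrm{rcv}(\mathrm{fix}\,X.P,c)=\mathrm{rcv}(P,c)$; $\mathrm{rcv}(\nu d{:}(n,v).W,c)=\mathrm{rcv}(W,c)$ for $d\ne c$; false otherwise. $\mathrm{rcv}(\Gamma\triangleright W,c)$ iff $c$ idle in $\Gamma$ and $\mathrm{rcv}(W,c)$. A configuration $\Gamma\triangleright W$ has $W$ closed. Intensional transitions $\Gamma\triangleright W\xrightarrow{\lambda}W'$, $\lambda\in\{c!v,c?v,\sigma,\tau\}$, form the least relation closed under: (Snd) $[\![e]\!]=v$ gives $\Gamma\triangleright c!\langle e\rangle.P\xrightarrow{c!v}\sigma^{\delta_v}.P$; (Rcv) $c$ idle gives $\Gamma\triangleright\lfloor c?(x).P\rfloor Q\xrightarrow{c?v}\lceil c?(x).P\rceil$; (RcvIgn) not $\mathrm{rcv}(\Gamma\triangleright W,c)$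 gives $\Gamma\triangleright W\xrightarrow{c?v}W$; (Sync) $W_1\xrightarrow{c!v}W_1'$, $W_2\xrightarrow{c?v}W_2'$ (under $\Gamma$) give $W_1|W_2\xrightarrow{c!v}W_1'|W_2'$, and symmetrically; (RcvPar) $W_i\xrightarrow{c?v}W_i'$ ($i=1,2$) give $W_1|W_2\xrightarrow{c?v}W_1'|W_2'$; (TimeNil) $\mathbf{nil}\xrightarrow{\sigma}\mathbf{nil}$; (Sleep) $\sigma.P\xrightarrow{\sigma}P$; (ActRcv) $\Gamma\vdash_t c:n>1$ gives $\lceil c?(x).P\rceil\xrightarrow{\sigma}\lceil c?(x).P\rceil$; (EndRcv) $\Gamma\vdash_t c:1$, $\Gamma\vdash_v c:w$ give $\lceil c?(x).P\rceil\xrightarrow{\sigma}\{w/x\}P$; (Timeout) $c$ idle gives $\lfloor c?(x).P\rfloor Q\xrightarrow{\sigma}Q$; (RcvLate) $c$ exposed gives $\lfloor c?(x).P\rfloor Q\xrightarrow{\tau}\lceil c?(x).\{\mathtt{err}/x\}P\rceil$; (Tau) $\tau.P\xrightarrow{\tau}P$; (Then)/(Else) $[b]P,Q\xrightarrow{\tau}\sigma.P$ if $[\![b]\!]_\Gamma$ true, $\xrightarrow{\tau}\sigma.Q$ if false; (TimePar) $W_i\xrightarrow{\sigma}W_i'$ give $W_1|W_2\xrightarrow{\sigma}W_1'|W_2'$; (TauPar) $W_1\xrightarrow{\tau}W_1'$ gives $W_1|W_2\xrightarrow{\tau}W_1'|W_2$, and symmetrically; (Rec) $\{\mathrm{fix}\,X.P/X\}P\xrightarrow{\lambda}W$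 gives $\mathrm{fix}\,X.P\xrightarrow{\lambda}W$; (Sum) $P\xrightarrow{\lambda}W$, $\lambda\in\{\tau,c!v\}$ gives $P+Q\xrightarrow{\lambda}W$, and symmetrically; (SumTime) $P\xrightarrow{\sigma}P'$, $Q\xrightarrow{\sigma}Q'$ give $P+Q\xrightarrow{\sigma}P'+Q'$; (SumRcv) $P\xrightarrow{c?v}W$ and $\mathrm{rcv}(\Gamma\triangleright P,c)$ give $P+Q\xrightarrow{c?v}W$, and symmetrically; (ResI) $\Gamma[c\mapsto(n,v)]\triangleright W\xrightarrow{c!w}W'$ gives $\Gamma\triangleright\nu c{:}(n,v).W\xrightarrow{\tau}\nu c{:}(c!w(\Gamma[c\mapsto(n,v)])(c)).W'$; (ResV) $\Gamma[c\mapsto(n,v)]\triangleright W\xrightarrow{\lambda}W'$ with $c$ not in $\lambda$ gives $\Gamma\triangleright\nu c{:}(n,v).W\xrightarrow{\lambda}\nu c{:}(n,v).W'$. Reductions: $\Gamma\triangleright W\to\Gamma'\triangleright W'$ iff $\Gamma\triangleright W\xrightarrow{\lambda}W'$, $\lambda\in\{c!v,\sigma,\tau\}$, $\Gamma'=\lambda(\Gamma)$. Extensional transitions: (Input) $\Gamma\triangleright W\xrightarrow{c?v}W'$ gives $\Gamma\triangleright W\xrightarrow{c?v}_e c?v(\Gamma)\triangleright W'$; (Time) $\xrightarrow{\sigma}W'$ gives $\xrightarrow{\sigma}_e\sigma(\Gamma)\triangleright W'$; (Shh) $\xrightarrow{c!v}W'$ gives $\xrightarrow{\tau}_e c!v(\Gamma)\triangleright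 W'$; (TauExt) $\xrightarrow{\tau}W'$ gives $\xrightarrow{\tau}_e\Gamma\triangleright W'$; (Deliver) $\Gamma(c)=(1,v)$ and $\xrightarrow{\sigma}W'$ give $\xrightarrow{\gamma(c,v)}_e\sigma(\Gamma)\triangleright W'$; (Idle) $c$ idle gives $\Gamma\triangleright W\xrightarrow{\iota(c)}_e\Gamma\triangleright W$. $\Longrightarrow_e$ is the reflexive transitive closure of $\xrightarrow{\tau}_e$, $\stackrel{\alpha}{\Longrightarrow}_e=\Longrightarrow_e\xrightarrow{\alpha}_e\Longrightarrow_e$, $\stackrel{\hat\alpha}{\Longrightarrow}_e$ is $\Longrightarrow_e$ for $\alpha=\tau$ and $\stackrel{\alpha}{\Longrightarrow}_e$ otherwise. A bisimulation is a relation $\mathcal R$ such that $\mathcal C_1\mathcal R\mathcal C_2$ and $\mathcal C_1\xrightarrow{\alpha}_e\mathcal C_1'$ imply $\mathcal C_2\stackrel{\hat\alpha}{\Longrightarrow}_e\mathcal C_2'$ with $\mathcal C_1'\mathcal R\mathcal C_2'$, and symmetrically; $\approx$ is the union of bisimulations. Barbs: $\Gamma\triangleright W\downarrow_c$ iff $c$ exposed in $\Gamma$; $\mathcal C\Downarrow_c$ iff $\mathcal C\to^*\mathcal C'\downarrow_c$. $\simeq$ is the largest symmetric relation $\mathcal R$ on configurations that is barb preserving ($\mathcal C_1\mathcal R\mathcal C_2$, $\mathcal C_1\Downarrow_c$ imply $\mathcal C_2\Downarrow_c$), reduction-closed ($\mathcal C_1\mathcal R\mathcal C_2$, $\mathcal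 C_1\to\mathcal C_1'$ imply $\mathcal C_2\to^*\mathcal C_2'$ with $\mathcal C_1'\mathcal R\mathcal C_2'$) and contextual ($(\Gamma_1\triangleright W_1)\mathcal R(\Gamma_2\triangleright W_2)$ implies $(\Gamma_1\triangleright W_1|W)\mathcal R(\Gamma_2\triangleright W_2|W)$ for all closed system terms $W$). Well-formed configurations form the least set such that: $\Gamma\triangleright P$ is well-formed for every process $P$; $\Gamma\triangleright\lceil c?(x).P\rceil$ is well-formed if $c$ is exposed in $\Gamma$; $\Gamma\triangleright W_1|W_2$ is well-formed if $\Gamma\triangleright W_1$ and $\Gamma\triangleright W_2$ are; $\Gamma\triangleright\nu c{:}(n,v).W$ is well-formed if $\Gamma[c\mapsto(n,v)]\triangleright W$ is. -}

module Defs where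

open import Level using (0ℓ)
open import Data.Nat using (ℕ; zero; suc; _≤_; _<_; _∸_; _⊔_; _≟_)
open import Data.Fin using (Fin; zero; suc)
open import Data.Vec using (Vec; []; _∷_)
open import Data.Product using (Σ; _×_; _,_; proj₁; proj₂; ∃; ∃-syntax)
open import Data.Unit using (⊤)
open import Relation.Nullary using (¬_; yes; no)
open import Relation.Binary using (Rel)
open import Relation.Binary.PropositionalEquality using (_≡_)
open import Relation.Binary.Construct.Closure.ReflexiveTransitive using (Star)

-- The parameters fixed by the paper: closed values (including the
-- distinguished error value err), positive transmission times, and an
-- expression language built from values by (arbitrary) operators with an
-- evaluation map.  Channels are natural numbers (countably many); bound
-- channels (ν) and bound data/process variables use de Bruijn indices,
-- so terms are automatically taken up to α-conversion.

record Sig : Set₁ where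
  field
    Val   : Set
    err   : Val
    δ     : Val → ℕ             -- transmission time
    δ-pos : ∀ v → 1 ≤ δ v
    Op    : Set
    arity : Op → ℕ
    ⟦_⟧op : (f : Op) → Vec Val (arity f) → Val

module CCCP (S : Sig) where
  open Sig S

  Chan : Set
  Chan = ℕ

  data Expr (n : ℕ) : Set where
    var : Fin n → Expr n
    val : Val → Expr n
    op  : (f : Op) → Vec (Expr n) (arity f) → Expr n

  mutual
    renE : ∀ {n k} → (Fin n → Fin k) → Expr n → Expr k
    renE ρ (var i) = var (ρ i)
    renE ρ (val v) = val v
    renE ρ (op f es) = op f (renEs ρ es)

    renEs : ∀ {n k a} → (Fin n → Fin k) → Vec (Expr n) a → Vec (Expr k) a
    renEs ρ [] = []
    renEs ρ (e ∷ es) = renE ρ e ∷ renEs ρ es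

  mutual
    subE : ∀ {n k} → (Fin n → Expr k) → Expr n → Expr k
    subE σ (var i) = σ i
    subE σ (val v) = val v
    subE σ (op f es) = op f (subEs σ es)

    subEs : ∀ {n k a} → (Fin n → Expr k) → Vec (Expr n) a → Vec (Expr k) a
    subEs σ [] = []
    subEs σ (e ∷ es) = subE σ e ∷ subEs σ es

  mutual
    eval : Expr 0 → Val
    eval (var ())
    eval (val v) = v
    eval (op f es) = ⟦ f ⟧op (evals es)

    evals : ∀ {a} → Vec (Expr 0) a → Vec Val a
    evals [] = []
    evals (e ∷ es) = eval e ∷ evals es

  data BExp (n : ℕ) : Set where
    eqb : Expr n → Expr n → BExp n
    expb : Chan → BExp n

  renB : ∀ {n k} → (Fin n → Fin k) → BExp n → BExp k
  renB ρ (eqb e₁ e₂) = eqb (renE ρ e₁) (renE ρ e₂)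
  renB ρ (expb c) = expb c

  subB : ∀ {n k} → (Fin n → Expr k) → BExp n → BExp k
  subB σ (eqb e₁ e₂) = eqb (subE σ e₁) (subE σ e₂)
  subB σ (expb c) = expb c

  data Proc (n m : ℕ) : Set where
    snd  : Chan → Expr n → Proc n m → Proc n m
    inp  : Chan → Proc (suc n) m → Proc n m → Proc n m
    slp  : Proc n m → Proc n m
    tau  : Proc n m → Proc n m
    _⊕_  : Proc n m → Proc n m → Proc n m
    cond : BExp n → Proc n m → Proc n m → Proc n m
    pvar : Fin m → Proc n m
    nil  : Proc n m
    fix  : Proc n (suc m) → Proc n m

  renP : ∀ {n n' m m'} → (Fin n → Fin n') → (Fin m → Fin m') → Proc n m → Proc n' m'
  renP ρ π (snd c e P) = snd c (renE ρ e) (renP ρ π P)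
  renP ρ π (inp c P Q) = inp c (renP (λ { zero → zero ; (suc i) → suc (ρ i) }) π P) (renP ρ π Q)
  renP ρ π (slp P) = slp (renP ρ π P)
  renP ρ π (tau P) = tau (renP ρ π P)
  renP ρ π (P ⊕ Q) = renP ρ π P ⊕ renP ρ π Q
  renP ρ π (cond b P Q) = cond (renB ρ b) (renP ρ π P) (renP ρ π Q)
  renP ρ π (pvar i) = pvar (π i)
  renP ρ π nil = nil
  renP ρ π (fix P) = fix (renP ρ (λ { zero → zero ; (suc i) → suc (π i) }) P)

  subD : ∀ {n k m} → (Fin n → Expr k) → Proc n m → Proc k m
  subD σ (snd c e P) = snd c (subE σ e) (subD σ P)
  subD σ (inp c P Q) = inp c (subD (λ { zero → var zero ; (suc i) → renE suc (σ i) }) P) (subD σ Q)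
  subD σ (slp P) = slp (subD σ P)
  subD σ (tau P) = tau (subD σ P)
  subD σ (P ⊕ Q) = subD σ P ⊕ subD σ Q
  subD σ (cond b P Q) = cond (subB σ b) (subD σ P) (subD σ Q)
  subD σ (pvar i) = pvar i
  subD σ nil = nil
  subD σ (fix P) = fix (subD σ P)

  subP : ∀ {n m m'} → (Fin m → Proc n m') → Proc n m → Proc n m'
  subP σ (snd c e P) = snd c e (subP σ P)
  subP σ (inp c P Q) = inp c (subP (λ i → renP suc (λ j → j) (σ i)) P) (subP σ Q)
  subP σ (slp P) = slp (subP σ P)
  subP σ (tau P) = tau (subP σ P)
  subP σ (P ⊕ Q) = subP σ P ⊕ subP σ Q
  subP σ (cond b P Q) = cond b (subP σ P) (subP σ Q)
  subP σ (pvar i) = σ i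
  subP σ nil = nil
  subP σ (fix P) = fix (subP (λ { zero → pvar zero ; (suc i) → renP (λ j → j) suc (σ i) }) P)

  _[_] : Proc 1 0 → Val → Proc 0 0
  P [ w ] = subD (λ _ → val w) P

  unfold : Proc 0 1 → Proc 0 0
  unfold P = subP (λ _ → fix P) P

  wk : Proc 0 0 → Proc 1 0
  wk = renP (λ ()) (λ i → i)

  sleeps : ℕ → Proc 0 0 → Proc 0 0
  sleeps zero P = P
  sleeps (suc k) P = slp (sleeps k P)

  data Unguarded {n : ℕ} : ∀ {m} → Fin m → Proc n m → Set where
    uvar  : ∀ {m} {i : Fin m} → Unguarded i (pvar i)
    utau  : ∀ {m} {i : Fin m} {P} → Unguarded i P → Unguarded i (tau P)
    usumL : ∀ {m} {i : Fin m} {P Q} → Unguarded i P → Unguarded i (P ⊕ Q)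
    usumR : ∀ {m} {i : Fin m} {P Q} → Unguarded i Q → Unguarded i (P ⊕ Q)
    ufix  : ∀ {m} {i : Fin m} {P} → Unguarded (suc i) P → Unguarded i (fix P)

  GuardedP : ∀ {n m} → Proc n m → Set
  GuardedP (snd c e P) = GuardedP P
  GuardedP (inp c P Q) = GuardedP P × GuardedP Q
  GuardedP (slp P) = GuardedP P
  GuardedP (tau P) = GuardedP P
  GuardedP (P ⊕ Q) = GuardedP P × GuardedP Q
  GuardedP (cond b P Q) = GuardedP P × GuardedP Q
  GuardedP (pvar i) = ⊤
  GuardedP nil = ⊤
  GuardedP (fix P) = (¬ Unguarded zero P) × GuardedP P

  -- closed system terms (channels bound by ν are de Bruijn: inside
  -- ν c:(n,v).W the new channel is 0 and outer channel k is suc k)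
  data Sys : Set where
    proc : Proc 0 0 → Sys
    act  : Chan → Proc 1 0 → Sys
    _∥_  : Sys → Sys → Sys
    nu   : ℕ → Val → Sys → Sys

  GuardedS : Sys → Set
  GuardedS (proc P) = GuardedP P
  GuardedS (act c P) = GuardedP P
  GuardedS (W₁ ∥ W₂) = GuardedS W₁ × GuardedS W₂
  GuardedS (nu n v W) = GuardedS W

  Env : Set
  Env = Chan → ℕ × Val

  Idle : Env → Chan → Set
  Idle Γ c = proj₁ (Γ c) ≡ 0

  Exposed : Env → Chan → Set
  Exposed Γ c = 1 ≤ proj₁ (Γ c)

  -- Γ[c ↦ (n,v)] for the bound channel of ν (de Bruijn index 0)
  ext : ℕ × Val → Env → Env
  ext p Γ zero = p
  ext p Γ (suc k) = Γ k

  upd : Env → Chan → ℕ × Val → Env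
  upd Γ c p d with d ≟ c
  ... | yes _ = p
  ... | no _ = Γ d

  sndState : ℕ × Val → Val → ℕ × Val
  sndState (zero , _) v = (δ v , v)
  sndState (suc t , _) v = (δ v ⊔ suc t , err)

  σEnv : Env → Env
  σEnv Γ c = (proj₁ (Γ c) ∸ 1 , proj₂ (Γ c))

  sndEnv : Chan → Val → Env → Env
  sndEnv c v Γ = upd Γ c (sndState (Γ c) v)

  data Label : Set where
    l! : Chan → Val → Label
    l? : Chan → Val → Label
    lσ : Label
    lτ : Label

  applyL : Label → Env → Env
  applyL (l! c v) Γ = sndEnv c v Γ
  applyL (l? c v) Γ = sndEnv c v Γ
  applyL lσ Γ = σEnv Γ
  applyL lτ Γ = Γ

  upL : Label → Label
  upL (l! c v) = l! (suc c) v
  upL (l? c v) = l? (suc c) v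
  upL lσ = lσ
  upL lτ = lτ

  data SumLab : Label → Set where
    sτ : SumLab lτ
    s! : ∀ {c v} → SumLab (l! c v)

  data RedLab : Label → Set where
    r! : ∀ {c v} → RedLab (l! c v)
    rσ : RedLab lσ
    rτ : RedLab lτ

  data RcvP {n m : ℕ} : Proc n m → Chan → Set where
    rhere : ∀ {c P Q} → RcvP (inp c P Q) c
    rsumL : ∀ {c P Q} → RcvP P c → RcvP (P ⊕ Q) c
    rsumR : ∀ {c P Q} → RcvP Q c → RcvP (P ⊕ Q) c
    rfix  : ∀ {c P} → RcvP P c → RcvP (fix P) c

  data RcvS : Sys → Chan → Set where
    rproc : ∀ {P c} → RcvP P c → RcvS (proc P) c
    rparL : ∀ {W₁ W₂ c} → RcvS W₁ c → RcvS (W₁ ∥ W₂) c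
    rparR : ∀ {W₁ W₂ c} → RcvS W₂ c → RcvS (W₁ ∥ W₂) c
    rnu   : ∀ {n v W c} → RcvS W (suc c) → RcvS (nu n v W) c

  RcvC : Env → Sys → Chan → Set
  RcvC Γ W c = Idle Γ c × RcvS W c

  BTrue : Env → BExp 0 → Set
  BTrue Γ (eqb e₁ e₂) = eval e₁ ≡ eval e₂
  BTrue Γ (expb c) = Exposed Γ c

  data Step : Env → Sys → Label → Sys → Set where
    Snd     : ∀ {Γ c e P} → Step Γ (proc (snd c e P)) (l! c (eval e)) (proc (sleeps (δ (eval e)) P))
    Rcv     : ∀ {Γ c P Q v} → Idle Γ c → Step Γ (proc (inp c P Q)) (l? c v) (act c P)
    RcvIgn  : ∀ {Γ W c v} → ¬ RcvC Γ W c → Step Γ W (l? c v) W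
    SyncL   : ∀ {Γ W₁ W₂ W₁' W₂' c v} → Step Γ W₁ (l! c v) W₁' → Step Γ W₂ (l? c v) W₂' →
              Step Γ (W₁ ∥ W₂) (l! c v) (W₁' ∥ W₂')
    SyncR   : ∀ {Γ W₁ W₂ W₁' W₂' c v} → Step Γ W₁ (l? c v) W₁' → Step Γ W₂ (l! c v) W₂' →
              Step Γ (W₁ ∥ W₂) (l! c v) (W₁' ∥ W₂')
    RcvPar  : ∀ {Γ W₁ W₂ W₁' W₂' c v} → Step Γ W₁ (l? c v) W₁' → Step Γ W₂ (l? c v) W₂' →
              Step Γ (W₁ ∥ W₂) (l? c v) (W₁' ∥ W₂')
    TimeNil : ∀ {Γ} → Step Γ (proc nil) lσ (proc nil)
    Sleep   : ∀ {Γ P} → Step Γ (proc (slp P)) lσ (proc P)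
    ActRcv  : ∀ {Γ c P} → 1 < proj₁ (Γ c) → Step Γ (act c P) lσ (act c P)
    EndRcv  : ∀ {Γ c P w} → Γ c ≡ (1 , w) → Step Γ (act c P) lσ (proc (P [ w ]))
    Timeout : ∀ {Γ c P Q} → Idle Γ c → Step Γ (proc (inp c P Q)) lσ (proc Q)
    RcvLate : ∀ {Γ c P Q} → Exposed Γ c → Step Γ (proc (inp c P Q)) lτ (act c (wk (P [ err ])))
    Tau     : ∀ {Γ P} → Step Γ (proc (tau P)) lτ (proc P)
    Then    : ∀ {Γ b P Q} → BTrue Γ b → Step Γ (proc (cond b P Q)) lτ (proc (slp P))
    Else    : ∀ {Γ b P Q} → ¬ BTrue Γ b → Step Γ (proc (cond b P Q)) lτ (proc (slp Q))
    TimePar : ∀ {Γ W₁ W₂ W₁' W₂'} → Step Γ W₁ lσ W₁' → Step Γ W₂ lσ W₂' →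
              Step Γ (W₁ ∥ W₂) lσ (W₁' ∥ W₂')
    TauParL : ∀ {Γ W₁ W₂ W₁'} → Step Γ W₁ lτ W₁' → Step Γ (W₁ ∥ W₂) lτ (W₁' ∥ W₂)
    TauParR : ∀ {Γ W₁ W₂ W₂'} → Step Γ W₂ lτ W₂' → Step Γ (W₁ ∥ W₂) lτ (W₁ ∥ W₂')
    Rec     : ∀ {Γ P l W} → Step Γ (proc (unfold P)) l W → Step Γ (proc (fix P)) l W
    SumL    : ∀ {Γ P Q l W} → SumLab l → Step Γ (proc P) l W → Step Γ (proc (P ⊕ Q)) l W
    SumR    : ∀ {Γ P Q l W} → SumLab l → Step Γ (proc Q) l W → Step Γ (proc (P ⊕ Q)) l W
    SumTime : ∀ {Γ P Q P' Q'} → Step Γ (proc P) lσ (proc P') → Step Γ (proc Q) lσ (proc Q') →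
              Step Γ (proc (P ⊕ Q)) lσ (proc (P' ⊕ Q'))
    SumRcvL : ∀ {Γ P Q c v W} → Step Γ (proc P) (l? c v) W → RcvC Γ (proc P) c →
              Step Γ (proc (P ⊕ Q)) (l? c v) W
    SumRcvR : ∀ {Γ P Q c v W} → Step Γ (proc Q) (l? c v) W → RcvC Γ (proc Q) c →
              Step Γ (proc (P ⊕ Q)) (l? c v) W
    ResI    : ∀ {Γ n v W W' w} → Step (ext (n , v) Γ) W (l! 0 w) W' →
              Step Γ (nu n v W) lτ
                   (nu (proj₁ (sndState (n , v) w)) (proj₂ (sndState (n , v) w)) W')
    ResV    : ∀ {Γ n v W W' l} → Step (ext (n , v) Γ) W (upL l) W' →
              Step Γ (nu n v W) l (nu n v W')

  Config : Set
  Config = Env × Sys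

  data _⟶_ : Config → Config → Set where
    red : ∀ {Γ W l W'} → Step Γ W l W' → RedLab l → (Γ , W) ⟶ (applyL l Γ , W')

  _↓_ : Config → Chan → Set
  C ↓ c = Exposed (proj₁ C) c

  _⇓_ : Config → Chan → Set
  C ⇓ c = ∃[ C' ] (Star _⟶_ C C' × C' ↓ c)

  data ELabel : Set where
    e? : Chan → Val → ELabel
    eσ : ELabel
    eτ : ELabel
    eγ : Chan → Val → ELabel
    eι : Chan → ELabel

  data _—[_]→ₑ_ : Config → ELabel → Config → Set where
    Input   : ∀ {Γ W W' c v} → Step Γ W (l? c v) W' → (Γ , W) —[ e? c v ]→ₑ (sndEnv c v Γ , W')
    Time    : ∀ {Γ W W'} → Step Γ W lσ W' → (Γ , W) —[ eσ ]→ₑ (σEnv Γ , W')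
    Shh     : ∀ {Γ W W' c v} → Step Γ W (l! c v) W' → (Γ , W) —[ eτ ]→ₑ (sndEnv c v Γ , W')
    TauExt  : ∀ {Γ W W'} → Step Γ W lτ W' → (Γ , W) —[ eτ ]→ₑ (Γ , W')
    Deliver : ∀ {Γ W W' c v} → Γ c ≡ (1 , v) → Step Γ W lσ W' → (Γ , W) —[ eγ c v ]→ₑ (σEnv Γ , W')
    IdleE   : ∀ {Γ W c} → Idle Γ c → (Γ , W) —[ eι c ]→ₑ (Γ , W)

  _⟹ₑ_ : Config → Config → Set
  _⟹ₑ_ = Star (λ C C' → C —[ eτ ]→ₑ C')

  WeakHat : ELabel → Config → Config → Set
  WeakHat eτ C C' = C ⟹ₑ C'
  WeakHat α C C' = ∃[ D ] ∃[ D' ] (C ⟹ₑ D × D —[ α ]→ₑ D' × D' ⟹ₑ C')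

  IsBisimulation : Rel Config 0ℓ → Set
  IsBisimulation R =
    (∀ {C₁ C₂ α C₁'} → R C₁ C₂ → C₁ —[ α ]→ₑ C₁' → ∃[ C₂' ] (WeakHat α C₂ C₂' × R C₁' C₂')) ×
    (∀ {C₁ C₂ α C₂'} → R C₁ C₂ → C₂ —[ α ]→ₑ C₂' → ∃[ C₁' ] (WeakHat α C₁ C₁' × R C₁' C₂'))

  _≈_ : Config → Config → Set₁
  C₁ ≈ C₂ = Σ (Rel Config 0ℓ) λ R → IsBisimulation R × R C₁ C₂

  record IsRBC (R : Rel Config 0ℓ) : Set where
    field
      symm       : ∀ {C₁ C₂} → R C₁ C₂ → R C₂ C₁
      barbs      : ∀ {C₁ C₂ c} → R C₁ C₂ → C₁ ⇓ c → C₂ ⇓ c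
      redClosed  : ∀ {C₁ C₂ C₁'} → R C₁ C₂ → C₁ ⟶ C₁' → ∃[ C₂' ] (Star _⟶_ C₂ C₂' × R C₁' C₂')
      contextual : ∀ {Γ₁ W₁ Γ₂ W₂} → R (Γ₁ , W₁) (Γ₂ , W₂) →
                   ∀ (W : Sys) → GuardedS W → R (Γ₁ , (W₁ ∥ W)) (Γ₂ , (W₂ ∥ W))

  _≃_ : Config → Config → Set₁
  C₁ ≃ C₂ = Σ (Rel Config 0ℓ) λ R → IsRBC R × R C₁ C₂

  data WF : Env → Sys → Set where
    wproc : ∀ {Γ P} → WF Γ (proc P)
    wact  : ∀ {Γ c P} → Exposed Γ c → WF Γ (act c P)
    wpar  : ∀ {Γ W₁ W₂} → WF Γ W₁ → WF Γ W₂ → WF Γ (W₁ ∥ W₂)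
    wnu   : ∀ {Γ n v W} → WF (ext (n , v) Γ) W → WF Γ (nu n v W)

  WellFormed : Config → Set
  WellFormed (Γ , W) = WF Γ W

  Legal : Config → Set
  Legal (Γ , W) = GuardedS W

{-# OPTIONS --safe #-}
-- Let a beacon on d broadcast on d forever, and let the lock on d be the
-- choice τ.nil + τ.beacon.  An undecided lock blocks time, and all its
-- descendants can be told apart: a configuration in which d is fresh reaches,
-- since time can pass, one without barb on d, whereas a beacon always keeps
-- its barb.  As σ-steps count as reductions and all channels may be exposed at
-- the outset, tests must be based on such eventual behaviour.
--
-- Relate C and D if, for some fresh d, they are congruent when run in parallel
-- with the lock on d.  A reduction of C in that context can only be matched by
-- τ-steps of D, the lock remaining undecided.  Time steps are matched by adding
-- a delayed lock on another channel and releasing the first one; inputs,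
-- deliveries and idleness by adding a test which beacons unless it succeeds
-- and which is inert afterwards, so that it can be discarded.
--
-- That time can pass holds only up to double negation, as truth of Boolean
-- expressions is undecidable, but it is needed only to refute wrong matches.
module Submission where

open import Data.Empty using (⊥; ⊥-elim)
open import Data.Fin using (Fin; zero; suc)
open import Data.Nat using (ℕ; zero; suc; _+_; _∸_; _⊔_; _≤_; _<_; _≟_; z≤n; s≤s)
open import Data.Nat.Properties using (≤-refl; ≤-trans; ≤-reflexive; <-≤-trans; <-irrefl; <⇒≢; <⇒≤; 1+n≢n; n≤1+n; m≤m⊔n; m≤n⊔m; m≤m+n; m≤n+m; +-mono-≤; +-mono-<-≤; +-mono-≤-<; ∸-monoˡ-≤)
open import Data.Product using (_×_; _,_; proj₁; proj₂; ∃-syntax)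
open import Data.Sum using (_⊎_; inj₁; inj₂)
open import Data.Unit using (⊤; tt)
open import Level using (0ℓ)
open import Relation.Binary using (Rel)
open import Relation.Binary.Construct.Closure.ReflexiveTransitive using (Star; ε; _◅_; _◅◅_; gmap; map)
open import Relation.Binary.PropositionalEquality using (_≡_; _≢_; refl; sym; ≢-sym; trans; cong; cong₂; subst)
open import Relation.Nullary using (¬_; yes; no)
open import Defs

module Completeness (S : Sig) where
  open Sig S
  open CCCP S

  -- Syntactic invariants of transitions

  -- Lifting below a restriction: the bound channel, index 0, is always permitted.
  _↑ : (Chan → Set) → Chan → Set
  (A ↑) zero = ⊤
  (A ↑) (suc c) = A c

  ChP : (Chan → Set) → ∀ {n m} → Proc n m → Set
  ChP A (snd c e P) = A c × ChP A P
  ChP A (inp c P Q) = A c × ChP A P × ChP A Q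
  ChP A (slp P) = ChP A P
  ChP A (tau P) = ChP A P
  ChP A (P ⊕ Q) = ChP A P × ChP A Q
  ChP A (cond b P Q) = ChP A P × ChP A Q
  ChP A (pvar i) = ⊤
  ChP A nil = ⊤
  ChP A (fix P) = ChP A P

  -- Only channels on which a term may yet send or start to receive count;
  -- the channel of an active receiver does not.
  ChS : (Chan → Set) → Sys → Set
  ChS A (proc P) = ChP A P
  ChS A (act c P) = ChP A P
  ChS A (V ∥ W) = ChS A V × ChS A W
  ChS A (nu n v W) = ChS (A ↑) W

  ChP-mono : ∀ {A B : Chan → Set} → (∀ c → A c → B c) → ∀ {n m} (P : Proc n m) → ChP A P → ChP B P
  ChP-mono f (snd c e P) (a , p) = f c a , ChP-mono f P p
  ChP-mono f (inp c P Q) (a , p , q) = f c a , ChP-mono f P p , ChP-mono f Q q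
  ChP-mono f (slp P) p = ChP-mono f P p
  ChP-mono f (tau P) p = ChP-mono f P p
  ChP-mono f (P ⊕ Q) (p , q) = ChP-mono f P p , ChP-mono f Q q
  ChP-mono f (cond b P Q) (p , q) = ChP-mono f P p , ChP-mono f Q q
  ChP-mono f (pvar i) p = tt
  ChP-mono f nil p = tt
  ChP-mono f (fix P) p = ChP-mono f P p

  ChS-mono : ∀ {A B : Chan → Set} → (∀ c → A c → B c) → ∀ W → ChS A W → ChS B W
  ChS-mono f (proc P) p = ChP-mono f P p
  ChS-mono f (act c P) p = ChP-mono f P p
  ChS-mono f (V ∥ W) (p , q) = ChS-mono f V p , ChS-mono f W q
  ChS-mono f (nu n v W) p = ChS-mono (λ { zero a → tt ; (suc c) a → f c a }) W p

  <-⊔ˡ : ∀ k l c → c < k → c < k ⊔ l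
  <-⊔ˡ k l c p = <-≤-trans p (m≤m⊔n k l)

  <-⊔ʳ : ∀ k l c → c < l → c < k ⊔ l
  <-⊔ʳ k l c p = <-≤-trans p (m≤n⊔m k l)

  boundP : ∀ {n m} (P : Proc n m) → ∃[ k ] ChP (_< k) P
  boundP₂ : ∀ {n m n' m'} (P : Proc n m) (Q : Proc n' m') → ∃[ k ] (ChP (_< k) P × ChP (_< k) Q)

  boundP (snd c e P) with boundP P
  ... | k , p = suc c ⊔ k , <-⊔ˡ (suc c) k c ≤-refl , ChP-mono (<-⊔ʳ (suc c) k) P p
  boundP (inp c P Q) with boundP₂ P Q
  ... | k , p , q = suc c ⊔ k , <-⊔ˡ (suc c) k c ≤-refl
                  , ChP-mono (<-⊔ʳ (suc c) k) P p , ChP-mono (<-⊔ʳ (suc c) k) Q q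
  boundP (slp P) = boundP P
  boundP (tau P) = boundP P
  boundP (P ⊕ Q) = boundP₂ P Q
  boundP (cond b P Q) = boundP₂ P Q
  boundP (pvar i) = 0 , tt
  boundP nil = 0 , tt
  boundP (fix P) = boundP P

  boundP₂ P Q with boundP P | boundP Q
  ... | k , p | l , q = k ⊔ l , ChP-mono (<-⊔ˡ k l) P p , ChP-mono (<-⊔ʳ k l) Q q

  boundS : ∀ W → ∃[ k ] ChS (_< k) W
  boundS (proc P) = boundP P
  boundS (act c P) = boundP P
  boundS (V ∥ W) with boundS V | boundS W
  ... | k , p | l , q = k ⊔ l , ChS-mono (<-⊔ˡ k l) V p , ChS-mono (<-⊔ʳ k l) W q
  boundS (nu n v W) with boundS W
  -- Outer channels are shifted by one inside, so the inner bound also holds outside.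
  ... | k , p = k , ChS-mono (λ { zero a → tt ; (suc c) a → ≤-trans (n≤1+n _) a }) W p

  ChP-renP : ∀ {A n n' m m'} {ρ : Fin n → Fin n'} {π : Fin m → Fin m'} (P : Proc n m) → ChP A P → ChP A (renP ρ π P)
  ChP-renP (snd c e P) (a , p) = a , ChP-renP P p
  ChP-renP (inp c P Q) (a , p , q) = a , ChP-renP P p , ChP-renP Q q
  ChP-renP (slp P) p = ChP-renP P p
  ChP-renP (tau P) p = ChP-renP P p
  ChP-renP (P ⊕ Q) (p , q) = ChP-renP P p , ChP-renP Q q
  ChP-renP (cond b P Q) (p , q) = ChP-renP P p , ChP-renP Q q
  ChP-renP (pvar i) p = tt
  ChP-renP nil p = tt
  ChP-renP (fix P) p = ChP-renP P p

  ChP-subD : ∀ {A n k m} {s : Fin n → Expr k} (P : Proc n m) → ChP A P → ChP A (subD s P)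
  ChP-subD (snd c e P) (a , p) = a , ChP-subD P p
  ChP-subD (inp c P Q) (a , p , q) = a , ChP-subD P p , ChP-subD Q q
  ChP-subD (slp P) p = ChP-subD P p
  ChP-subD (tau P) p = ChP-subD P p
  ChP-subD (P ⊕ Q) (p , q) = ChP-subD P p , ChP-subD Q q
  ChP-subD (cond b P Q) (p , q) = ChP-subD P p , ChP-subD Q q
  ChP-subD (pvar i) p = tt
  ChP-subD nil p = tt
  ChP-subD (fix P) p = ChP-subD P p

  ChP-subP : ∀ {A n m m'} {s : Fin m → Proc n m'} (P : Proc n m) → (∀ i → ChP A (s i)) → ChP A P → ChP A (subP s P)
  ChP-subP (snd c e P) h (a , p) = a , ChP-subP P h p
  ChP-subP {s = s} (inp c P Q) h (a , p , q) = a , ChP-subP P (λ i → ChP-renP (s i) (h i)) p , ChP-subP Q h q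
  ChP-subP (slp P) h p = ChP-subP P h p
  ChP-subP (tau P) h p = ChP-subP P h p
  ChP-subP (P ⊕ Q) h (p , q) = ChP-subP P h p , ChP-subP Q h q
  ChP-subP (cond b P Q) h (p , q) = ChP-subP P h p , ChP-subP Q h q
  ChP-subP (pvar i) h p = h i
  ChP-subP nil h p = tt
  ChP-subP {s = s} (fix P) h p = ChP-subP P (λ { zero → tt ; (suc i) → ChP-renP (s i) (h i) }) p

  ChP-sleeps : ∀ {A} k {P} → ChP A P → ChP A (sleeps k P)
  ChP-sleeps zero p = p
  ChP-sleeps (suc k) p = ChP-sleeps k p

  ChS-step : ∀ {A Γ W l W'} → Step Γ W l W' → ChS A W → ChS A W'
  ChS-step (Snd {e = e}) (a , p) = ChP-sleeps (δ (eval e)) p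
  ChS-step (Rcv x) (a , p , q) = p
  ChS-step (RcvIgn x) p = p
  ChS-step (SyncL s t) (p , q) = ChS-step s p , ChS-step t q
  ChS-step (SyncR s t) (p , q) = ChS-step s p , ChS-step t q
  ChS-step (RcvPar s t) (p , q) = ChS-step s p , ChS-step t q
  ChS-step TimeNil p = p
  ChS-step Sleep p = p
  ChS-step (ActRcv x) p = p
  ChS-step (EndRcv {P = P} x) p = ChP-subD P p
  ChS-step (Timeout x) (a , p , q) = q
  ChS-step (RcvLate {P = P} x) (a , p , q) = ChP-renP (P [ err ]) (ChP-subD P p)
  ChS-step Tau p = p
  ChS-step (Then x) (p , q) = p
  ChS-step (Else x) (p , q) = q
  ChS-step (TimePar s t) (p , q) = ChS-step s p , ChS-step t q
  ChS-step (TauParL s) (p , q) = ChS-step s p , q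
  ChS-step (TauParR s) (p , q) = p , ChS-step s q
  ChS-step (Rec {P = P} s) p = ChS-step s (ChP-subP P (λ _ → p) p)
  ChS-step (SumL x s) (p , q) = ChS-step s p
  ChS-step (SumR x s) (p , q) = ChS-step s q
  ChS-step (SumTime s t) (p , q) = ChS-step s p , ChS-step t q
  ChS-step (SumRcvL s x) (p , q) = ChS-step s p
  ChS-step (SumRcvR s x) (p , q) = ChS-step s q
  ChS-step (ResI s) p = ChS-step s p
  ChS-step (ResV s) p = ChS-step s p

  ChS-send : ∀ {A Γ W c v W'} → Step Γ W (l! c v) W' → ChS A W → A c
  ChS-send Snd (a , p) = a
  ChS-send (SyncL s t) (p , q) = ChS-send s p
  ChS-send (SyncR s t) (p , q) = ChS-send t q
  ChS-send (Rec {P = P} s) p = ChS-send s (ChP-subP P (λ _ → p) p)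
  ChS-send (SumL x s) (p , q) = ChS-send s p
  ChS-send (SumR x s) (p , q) = ChS-send s q
  ChS-send (ResV s) p = ChS-send s p

  ChP-rcv : ∀ {A n m} {P : Proc n m} {c} → RcvP P c → ChP A P → A c
  ChP-rcv rhere (a , _) = a
  ChP-rcv (rsumL r) (p , q) = ChP-rcv r p
  ChP-rcv (rsumR r) (p , q) = ChP-rcv r q
  ChP-rcv (rfix r) p = ChP-rcv r p

  ChS-rcv : ∀ {A W c} → RcvS W c → ChS A W → A c
  ChS-rcv (rproc r) p = ChP-rcv r p
  ChS-rcv (rparL r) (p , q) = ChS-rcv r p
  ChS-rcv (rparR r) (p , q) = ChS-rcv r q
  ChS-rcv (rnu r) p = ChS-rcv r p

  -- Guardedness under renaming, substitution and transitions

  Unguarded-renP : ∀ {n n' m m'} {ρ : Fin n → Fin n'} {π : Fin m → Fin m'} (P : Proc n m) {j} →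
                   Unguarded j (renP ρ π P) → ∃[ i ] (π i ≡ j × Unguarded i P)
  Unguarded-renP (tau P) (utau u) with Unguarded-renP P u
  ... | i , e , w = i , e , utau w
  Unguarded-renP (P ⊕ Q) (usumL u) with Unguarded-renP P u
  ... | i , e , w = i , e , usumL w
  Unguarded-renP (P ⊕ Q) (usumR u) with Unguarded-renP Q u
  ... | i , e , w = i , e , usumR w
  Unguarded-renP (pvar i) uvar = i , refl , uvar
  Unguarded-renP (fix P) (ufix u) with Unguarded-renP P u
  ... | zero , () , w
  ... | suc i , refl , w = i , refl , ufix w

  Unguarded-subD : ∀ {n k m} {s : Fin n → Expr k} (P : Proc n m) {j} → Unguarded j (subD s P) → Unguarded j P
  Unguarded-subD (tau P) (utau u) = utau (Unguarded-subD P u)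
  Unguarded-subD (P ⊕ Q) (usumL u) = usumL (Unguarded-subD P u)
  Unguarded-subD (P ⊕ Q) (usumR u) = usumR (Unguarded-subD Q u)
  Unguarded-subD (pvar i) uvar = uvar
  Unguarded-subD (fix P) (ufix u) = ufix (Unguarded-subD P u)

  Unguarded-subP : ∀ {n m m'} {s : Fin m → Proc n m'} (P : Proc n m) {j} →
                   Unguarded j (subP s P) → ∃[ i ] (Unguarded i P × Unguarded j (s i))
  Unguarded-subP (tau P) (utau u) with Unguarded-subP P u
  ... | i , e , w = i , utau e , w
  Unguarded-subP (P ⊕ Q) (usumL u) with Unguarded-subP P u
  ... | i , e , w = i , usumL e , w
  Unguarded-subP (P ⊕ Q) (usumR u) with Unguarded-subP Q u
  ... | i , e , w = i , usumR e , w
  Unguarded-subP (pvar i) u = i , uvar , u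
  Unguarded-subP {s = s} (fix P) (ufix u) with Unguarded-subP P u
  ... | zero , e , ()
  ... | suc i , e , w with Unguarded-renP (s i) w
  ... | _ , refl , w' = i , ufix e , w'

  GuardedP-renP : ∀ {n n' m m'} {ρ : Fin n → Fin n'} {π : Fin m → Fin m'} (P : Proc n m) → GuardedP P → GuardedP (renP ρ π P)
  GuardedP-renP (snd c e P) p = GuardedP-renP P p
  GuardedP-renP (inp c P Q) (p , q) = GuardedP-renP P p , GuardedP-renP Q q
  GuardedP-renP (slp P) p = GuardedP-renP P p
  GuardedP-renP (tau P) p = GuardedP-renP P p
  GuardedP-renP (P ⊕ Q) (p , q) = GuardedP-renP P p , GuardedP-renP Q q
  GuardedP-renP (cond b P Q) (p , q) = GuardedP-renP P p , GuardedP-renP Q q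
  GuardedP-renP (pvar i) p = tt
  GuardedP-renP nil p = tt
  GuardedP-renP (fix P) (g , p) = guarded , GuardedP-renP P p
    where
    guarded : ¬ Unguarded zero _
    guarded u with Unguarded-renP P u
    ... | zero , _ , w = g w
    ... | suc i , () , w

  GuardedP-subD : ∀ {n k m} {s : Fin n → Expr k} (P : Proc n m) → GuardedP P → GuardedP (subD s P)
  GuardedP-subD (snd c e P) p = GuardedP-subD P p
  GuardedP-subD (inp c P Q) (p , q) = GuardedP-subD P p , GuardedP-subD Q q
  GuardedP-subD (slp P) p = GuardedP-subD P p
  GuardedP-subD (tau P) p = GuardedP-subD P p
  GuardedP-subD (P ⊕ Q) (p , q) = GuardedP-subD P p , GuardedP-subD Q q
  GuardedP-subD (cond b P Q) (p , q) = GuardedP-subD P p , GuardedP-subD Q q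
  GuardedP-subD (pvar i) p = tt
  GuardedP-subD nil p = tt
  GuardedP-subD (fix P) (g , p) = (λ u → g (Unguarded-subD P u)) , GuardedP-subD P p

  GuardedP-subP : ∀ {n m m'} {s : Fin m → Proc n m'} (P : Proc n m) → (∀ i → GuardedP (s i)) → GuardedP P → GuardedP (subP s P)
  GuardedP-subP (snd c e P) h p = GuardedP-subP P h p
  GuardedP-subP {s = s} (inp c P Q) h (p , q) = GuardedP-subP P (λ i → GuardedP-renP (s i) (h i)) p , GuardedP-subP Q h q
  GuardedP-subP (slp P) h p = GuardedP-subP P h p
  GuardedP-subP (tau P) h p = GuardedP-subP P h p
  GuardedP-subP (P ⊕ Q) h (p , q) = GuardedP-subP P h p , GuardedP-subP Q h q
  GuardedP-subP (cond b P Q) h (p , q) = GuardedP-subP P h p , GuardedP-subP Q h q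
  GuardedP-subP (pvar i) h p = h i
  GuardedP-subP nil h p = tt
  GuardedP-subP {s = s} (fix P) h (g , p) =
    guarded , GuardedP-subP P (λ { zero → tt ; (suc i) → GuardedP-renP (s i) (h i) }) p
    where
    guarded : ¬ Unguarded zero _
    guarded u with Unguarded-subP P u
    ... | zero , w , _ = g w
    -- What replaces an outer variable is shifted past the new one and hence does not mention it.
    ... | suc i , _ , w with Unguarded-renP (s i) w
    ... | _ , () , _

  GuardedP-unfold : ∀ P → GuardedP (fix P) → GuardedP (unfold P)
  GuardedP-unfold P (g , p) = GuardedP-subP P (λ _ → g , p) p

  GuardedP-sleeps : ∀ k {P} → GuardedP P → GuardedP (sleeps k P)
  GuardedP-sleeps zero p = p
  GuardedP-sleeps (suc k) p = GuardedP-sleeps k p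

  GuardedS-step : ∀ {Γ W l W'} → Step Γ W l W' → GuardedS W → GuardedS W'
  GuardedS-step (Snd {e = e}) p = GuardedP-sleeps (δ (eval e)) p
  GuardedS-step (Rcv x) (p , q) = p
  GuardedS-step (RcvIgn x) p = p
  GuardedS-step (SyncL s t) (p , q) = GuardedS-step s p , GuardedS-step t q
  GuardedS-step (SyncR s t) (p , q) = GuardedS-step s p , GuardedS-step t q
  GuardedS-step (RcvPar s t) (p , q) = GuardedS-step s p , GuardedS-step t q
  GuardedS-step TimeNil p = p
  GuardedS-step Sleep p = p
  GuardedS-step (ActRcv x) p = p
  GuardedS-step (EndRcv {P = P} x) p = GuardedP-subD P p
  GuardedS-step (Timeout x) (p , q) = q
  GuardedS-step (RcvLate {P = P} x) (p , q) = GuardedP-renP (P [ err ]) (GuardedP-subD P p)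
  GuardedS-step Tau p = p
  GuardedS-step (Then x) (p , q) = p
  GuardedS-step (Else x) (p , q) = q
  GuardedS-step (TimePar s t) (p , q) = GuardedS-step s p , GuardedS-step t q
  GuardedS-step (TauParL s) (p , q) = GuardedS-step s p , q
  GuardedS-step (TauParR s) (p , q) = p , GuardedS-step s q
  GuardedS-step (Rec {P = P} s) p = GuardedS-step s (GuardedP-unfold P p)
  GuardedS-step (SumL x s) (p , q) = GuardedS-step s p
  GuardedS-step (SumR x s) (p , q) = GuardedS-step s q
  GuardedS-step (SumTime s t) (p , q) = GuardedS-step s p , GuardedS-step t q
  GuardedS-step (SumRcvL s x) (p , q) = GuardedS-step s p
  GuardedS-step (SumRcvR s x) (p , q) = GuardedS-step s q
  GuardedS-step (ResI s) p = GuardedS-step s p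
  GuardedS-step (ResV s) p = GuardedS-step s p

  -- Environments and preservation of well-formedness

  upd-same : ∀ Γ c p → upd Γ c p c ≡ p
  upd-same Γ c p with c ≟ c
  ... | yes _ = refl
  ... | no c≢c = ⊥-elim (c≢c refl)

  upd-other : ∀ Γ c p {d} → d ≢ c → upd Γ c p d ≡ Γ d
  upd-other Γ c p {d} d≢c with d ≟ c
  ... | yes d≡c = ⊥-elim (d≢c d≡c)
  ... | no _ = refl

  δ≤sndState : ∀ p v → δ v ≤ proj₁ (sndState p v)
  δ≤sndState (zero , _) v = ≤-refl
  δ≤sndState (suc t , _) v = m≤m⊔n (δ v) (suc t)

  sndState-mono : ∀ p v → proj₁ p ≤ proj₁ (sndState p v)
  sndState-mono (zero , _) v = z≤n
  sndState-mono (suc t , _) v = m≤n⊔m (δ v) (suc t)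

  δ≤sndEnv : ∀ Γ c v → δ v ≤ proj₁ (sndEnv c v Γ c)
  δ≤sndEnv Γ c v rewrite upd-same Γ c (sndState (Γ c) v) = δ≤sndState (Γ c) v

  sndEnv-exposed : ∀ Γ c v → Exposed (sndEnv c v Γ) c
  sndEnv-exposed Γ c v = ≤-trans (δ-pos v) (δ≤sndEnv Γ c v)

  sndEnv-mono : ∀ Γ c v d → proj₁ (Γ d) ≤ proj₁ (sndEnv c v Γ d)
  sndEnv-mono Γ c v d with d ≟ c
  ... | yes refl = sndState-mono (Γ d) v
  ... | no _ = ≤-refl

  -- Well-formedness depends on the environment only through its exposed channels, so it is monotone
  -- in this order.
  _⊑_ : Env → Env → Set
  Γ ⊑ Δ = ∀ c → Exposed Γ c → Exposed Δ c

  sndEnv-⊑ : ∀ Γ c v → Γ ⊑ sndEnv c v Γ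
  sndEnv-⊑ Γ c v d x = ≤-trans x (sndEnv-mono Γ c v d)

  ext-⊑ : ∀ {Γ Δ p} → Γ ⊑ Δ → ext p Γ ⊑ ext p Δ
  ext-⊑ h zero x = x
  ext-⊑ h (suc c) x = h c x

  sndEnv-ext-⊑ : ∀ {Γ p} c v → sndEnv (suc c) v (ext p Γ) ⊑ ext p (sndEnv c v Γ)
  sndEnv-ext-⊑ c v zero x = x
  sndEnv-ext-⊑ {Γ} {p} c v (suc d) x with d ≟ c
  ... | yes refl = subst (1 ≤_) (cong proj₁ (upd-same (ext p Γ) (suc d) _)) x
  ... | no d≢c = subst (1 ≤_) (cong proj₁ (upd-other (ext p Γ) (suc c) _ λ { refl → d≢c refl })) x

  -- A step under ν leaves the timer of the bound channel untouched, even
  -- when it is a time step; hence only an inclusion.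
  applyL-ext-⊑ : ∀ {Γ p} l → applyL (upL l) (ext p Γ) ⊑ ext p (applyL l Γ)
  applyL-ext-⊑ (l! c v) = sndEnv-ext-⊑ c v
  applyL-ext-⊑ (l? c v) = sndEnv-ext-⊑ c v
  applyL-ext-⊑ {p = suc n , _} lσ zero x = s≤s z≤n
  applyL-ext-⊑ lσ (suc c) x = x
  applyL-ext-⊑ lτ c x = x

  WF-mono : ∀ {Γ Δ W} → Γ ⊑ Δ → WF Γ W → WF Δ W
  WF-mono h wproc = wproc
  WF-mono h (wact x) = wact (h _ x)
  WF-mono h (wpar w₁ w₂) = wpar (WF-mono h w₁) (WF-mono h w₂)
  WF-mono h (wnu w) = wnu (WF-mono (ext-⊑ h) w)

  -- The target is any `Δ` above `applyL l Γ`, because under `nu` the body ends in an environment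
  -- that is merely included in the required one.
  WF-step : ∀ {Γ Δ W l W'} → Step Γ W l W' → applyL l Γ ⊑ Δ → WF Γ W → WF Δ W'
  WF-step Snd h w = wproc
  WF-step {Γ} (Rcv {c = c} {v = v} x) h w = wact (h c (sndEnv-exposed Γ c v))
  WF-step {Γ} (RcvIgn {c = c} {v} x) h w = WF-mono (λ d e → h d (sndEnv-⊑ Γ c v d e)) w
  WF-step (SyncL s t) h (wpar w₁ w₂) = wpar (WF-step s h w₁) (WF-step t h w₂)
  WF-step (SyncR s t) h (wpar w₁ w₂) = wpar (WF-step s h w₁) (WF-step t h w₂)
  WF-step (RcvPar s t) h (wpar w₁ w₂) = wpar (WF-step s h w₁) (WF-step t h w₂)
  WF-step TimeNil h w = wproc
  WF-step Sleep h w = wproc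
  WF-step (ActRcv x) h w = wact (h _ (∸-monoˡ-≤ 1 x))
  WF-step (EndRcv x) h w = wproc
  WF-step (Timeout x) h w = wproc
  WF-step (RcvLate x) h w = wact (h _ x)
  WF-step Tau h w = wproc
  WF-step (Then x) h w = wproc
  WF-step (Else x) h w = wproc
  WF-step (TimePar s t) h (wpar w₁ w₂) = wpar (WF-step s h w₁) (WF-step t h w₂)
  WF-step (TauParL s) h (wpar w₁ w₂) = wpar (WF-step s h w₁) (WF-mono h w₂)
  WF-step (TauParR s) h (wpar w₁ w₂) = wpar (WF-mono h w₁) (WF-step s h w₂)
  WF-step (Rec s) h w = WF-step s h wproc
  WF-step (SumL x s) h w = WF-step s h wproc
  WF-step (SumR x s) h w = WF-step s h wproc
  WF-step (SumTime s t) h w = wproc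
  WF-step (SumRcvL s x) h w = WF-step s h wproc
  WF-step (SumRcvR s x) h w = WF-step s h wproc
  WF-step (ResI s) h (wnu w) = wnu (WF-step s (λ { zero x → x ; (suc c) x → h c x }) w)
  WF-step (ResV {l = l} s) h (wnu w) = wnu (WF-step s (λ c x → ext-⊑ h c (applyL-ext-⊑ l c x)) w)

  -- Invariants of reduction: the first two let time pass, the third keeps test channels fresh.
  record Tame (A : Chan → Set) (C : Config) : Set where
    constructor tame
    field
      wf : WellFormed C
      legal : Legal C
      chans : ChS A (proj₂ C)
  open Tame

  Tame-step : ∀ {A Γ W l W'} → Step Γ W l W' → Tame A (Γ , W) → Tame A (applyL l Γ , W')
  Tame-step s (tame w g h) = tame (WF-step s (λ _ x → x) w) (GuardedS-step s g) (ChS-step s h)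

  Tame-mono : ∀ {A B : Chan → Set} {C} → (∀ c → A c → B c) → Tame A C → Tame B C
  Tame-mono {C = C} f (tame w g h) = tame w g (ChS-mono f (proj₂ C) h)

  -- Instantaneous actions are bounded, so time can pass

  -- Counting a recursion as one makes it decrease along unfolding as well.
  burst : ∀ {n m} → Proc n m → ℕ
  burst (snd c e P) = 1
  burst (inp c P Q) = 1
  burst (slp P) = 0
  burst (tau P) = suc (burst P)
  burst (P ⊕ Q) = suc (burst P + burst Q)
  burst (cond b P Q) = 1
  burst (pvar i) = 0
  burst nil = 0
  burst (fix P) = suc (burst P)

  burstS : Sys → ℕ
  burstS (proc P) = burst P
  burstS (act c P) = 0
  burstS (V ∥ W) = burstS V + burstS W
  burstS (nu n v W) = burstS W

  burst-renP : ∀ {n n' m m'} {ρ : Fin n → Fin n'} {π : Fin m → Fin m'} (P : Proc n m) → burst (renP ρ π P) ≡ burst P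
  burst-renP (snd c e P) = refl
  burst-renP (inp c P Q) = refl
  burst-renP (slp P) = refl
  burst-renP (tau P) = cong suc (burst-renP P)
  burst-renP (P ⊕ Q) = cong suc (cong₂ _+_ (burst-renP P) (burst-renP Q))
  burst-renP (cond b P Q) = refl
  burst-renP (pvar i) = refl
  burst-renP nil = refl
  burst-renP (fix P) = cong suc (burst-renP P)

  -- The count stops at guards, so only what replaces unguarded variables matters.
  burst-subP : ∀ {n m m'} {s : Fin m → Proc n m'} (P : Proc n m) →
               (∀ i → Unguarded i P → burst (s i) ≡ 0) → burst (subP s P) ≡ burst P
  burst-subP (snd c e P) h = refl
  burst-subP (inp c P Q) h = refl
  burst-subP (slp P) h = refl
  burst-subP (tau P) h = cong suc (burst-subP P (λ i u → h i (utau u)))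
  burst-subP (P ⊕ Q) h = cong suc (cong₂ _+_ (burst-subP P (λ i u → h i (usumL u))) (burst-subP Q (λ i u → h i (usumR u))))
  burst-subP (cond b P Q) h = refl
  burst-subP (pvar i) h = h i uvar
  burst-subP nil h = refl
  burst-subP {s = s} (fix P) h =
    cong suc (burst-subP P λ { zero u → refl ; (suc i) u → trans (burst-renP (s i)) (h i (ufix u)) })

  -- Guardedness makes the condition of `burst-subP` vacuous; with the one counted for `fix`,
  -- unfolding lowers the measure.
  burst-unfold : ∀ P → GuardedP (fix P) → burst (unfold P) ≡ burst P
  burst-unfold P (g , _) = burst-subP P λ { zero u → ⊥-elim (g u) }

  burst-sleeps : ∀ {k P} → 1 ≤ k → burst (sleeps k P) ≡ 0
  burst-sleeps (s≤s _) = refl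

  -- A receiver that starts to listen becomes active, which counts zero; hence a broadcast never
  -- raises the measure of the components that hear it.
  burstS-rcv : ∀ {Γ W c v W'} → GuardedS W → Step Γ W (l? c v) W' → burstS W' ≤ burstS W
  burstS-rcv g (Rcv x) = z≤n
  burstS-rcv g (RcvIgn x) = ≤-refl
  burstS-rcv (g , h) (RcvPar s t) = +-mono-≤ (burstS-rcv g s) (burstS-rcv h t)
  burstS-rcv g (Rec {P = P} s) =
    ≤-trans (burstS-rcv (GuardedP-unfold P g) s) (≤-trans (≤-reflexive (burst-unfold P g)) (n≤1+n _))
  burstS-rcv (g , h) (SumRcvL {P = P} {Q} s x) = ≤-trans (burstS-rcv g s) (≤-trans (m≤m+n _ (burst Q)) (n≤1+n _))
  burstS-rcv (g , h) (SumRcvR {P = P} {Q} s x) = ≤-trans (burstS-rcv h s) (≤-trans (m≤n+m _ (burst P)) (n≤1+n _))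
  burstS-rcv g (ResV s) = burstS-rcv g s

  -- A sender goes to sleep for at least one unit, as `δ` is positive, so nothing instantaneous is
  -- left of it.
  burstS-act : ∀ {Γ W l W'} → GuardedS W → SumLab l → Step Γ W l W' → burstS W' < burstS W
  burstS-act g s! (Snd {e = e} {P}) = s≤s (≤-reflexive (burst-sleeps {P = P} (δ-pos (eval e))))
  burstS-act (g , h) s! (SyncL s t) = +-mono-<-≤ (burstS-act g s! s) (burstS-rcv h t)
  burstS-act (g , h) s! (SyncR s t) = +-mono-≤-< (burstS-rcv g s) (burstS-act h s! t)
  burstS-act g sτ (RcvLate x) = s≤s z≤n
  burstS-act g sτ Tau = ≤-refl
  burstS-act g sτ (Then x) = ≤-refl
  burstS-act g sτ (Else x) = ≤-refl
  burstS-act (g , h) sτ (TauParL {W₂ = W} s) = +-mono-<-≤ (burstS-act g sτ s) (≤-refl {burstS W})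
  burstS-act (g , h) sτ (TauParR {W₁ = W} s) = +-mono-≤-< (≤-refl {burstS W}) (burstS-act h sτ s)
  burstS-act g x (Rec {P = P} s) =
    <-≤-trans (burstS-act (GuardedP-unfold P g) x s) (≤-trans (≤-reflexive (burst-unfold P g)) (n≤1+n _))
  burstS-act (g , h) x (SumL {Q = Q} _ s) = <-≤-trans (burstS-act g x s) (≤-trans (m≤m+n _ (burst Q)) (n≤1+n _))
  burstS-act (g , h) x (SumR {P = P} _ s) = <-≤-trans (burstS-act h x s) (≤-trans (m≤n+m _ (burst P)) (n≤1+n _))
  burstS-act g sτ (ResI s) = burstS-act g s! s
  burstS-act g s! (ResV s) = burstS-act g s! s
  burstS-act g sτ (ResV s) = burstS-act g sτ s

  ¬¬-em : ∀ {X : Set} → ¬ ¬ (X ⊎ ¬ X)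
  ¬¬-em k = k (inj₂ λ x → k (inj₁ x))

  RcvP-subP : ∀ {n m m'} {s : Fin m → Proc n m'} {P : Proc n m} {c} → RcvP P c → RcvP (subP s P) c
  RcvP-subP rhere = rhere
  RcvP-subP (rsumL r) = rsumL (RcvP-subP r)
  RcvP-subP (rsumR r) = rsumR (RcvP-subP r)
  RcvP-subP (rfix r) = rfix (RcvP-subP r)

  -- The bound `k` on the measure serves as recursion argument, since unfolding is not structural.
  receiveP : ∀ k {Γ} {P : Proc 0 0} {c v} → burst P < k → GuardedP P → Idle Γ c → RcvP P c →
             ∃[ W ] Step Γ (proc P) (l? c v) W
  receiveP (suc k) lt g i rhere = _ , Rcv i
  receiveP (suc k) {P = P ⊕ Q} (s≤s lt) (g , h) i (rsumL r)
    with receiveP k (≤-trans (s≤s (m≤m+n _ (burst Q))) lt) g i r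
  ... | W , s = W , SumRcvL s (i , rproc r)
  receiveP (suc k) {P = P ⊕ Q} (s≤s lt) (g , h) i (rsumR r)
    with receiveP k (≤-trans (s≤s (m≤n+m _ (burst P))) lt) h i r
  ... | W , s = W , SumRcvR s (i , rproc r)
  receiveP (suc k) {P = fix P} (s≤s lt) g i (rfix r)
    with receiveP k (≤-trans (s≤s (≤-reflexive (burst-unfold P g))) lt) (GuardedP-unfold P g) i (RcvP-subP r)
  ... | W , s = W , Rec s

  -- Components cannot block a broadcast: each of them either accepts the message or ignores it.
  receiveS : ∀ {Γ} W {c v} → GuardedS W → ¬ ¬ (∃[ W' ] Step Γ W (l? c v) W')
  receiveS {Γ} (proc P) {c} g k = ¬¬-em {RcvC Γ (proc P) c} λ
    { (inj₁ (i , rproc r)) → k (receiveP _ ≤-refl g i r)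
    ; (inj₂ n) → k (_ , RcvIgn n) }
  receiveS (act c P) g k = k (_ , RcvIgn λ { (_ , ()) })
  receiveS (V ∥ W) (g , h) k = receiveS V g λ { (_ , s) → receiveS W h λ { (_ , t) → k (_ , RcvPar s t) } }
  receiveS (nu n v W) g k = receiveS W g λ { (_ , s) → k (_ , ResV s) }

  Moves : Env → Sys → Set
  Moves Γ W = ∃[ l ] ∃[ W' ] (SumLab l × Step Γ W l W')

  -- Truth of Boolean expressions is undecidable, as values need not have
  -- decidable equality; hence the double negation.
  progressP : ∀ k {Γ} (P : Proc 0 0) → burst P < k → GuardedP P →
              ¬ ¬ (Moves Γ (proc P) ⊎ ∃[ P' ] Step Γ (proc P) lσ (proc P'))
  progressP (suc k) (snd c e P) lt g κ = κ (inj₁ (_ , _ , s! , Snd))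
  progressP (suc k) {Γ} (inp c P Q) lt g κ with proj₁ (Γ c) in eq
  ... | zero = κ (inj₂ (_ , Timeout eq))
  ... | suc n = κ (inj₁ (_ , _ , sτ , RcvLate (subst (1 ≤_) (sym eq) (s≤s z≤n))))
  progressP (suc k) (slp P) lt g κ = κ (inj₂ (_ , Sleep))
  progressP (suc k) (tau P) lt g κ = κ (inj₁ (_ , _ , sτ , Tau))
  progressP (suc k) (P ⊕ Q) (s≤s lt) (g , h) κ =
    progressP k P (≤-trans (s≤s (m≤m+n _ (burst Q))) lt) g λ
      { (inj₁ (_ , _ , x , s)) → κ (inj₁ (_ , _ , x , SumL x s))
      ; (inj₂ (_ , s)) → progressP k Q (≤-trans (s≤s (m≤n+m _ (burst P))) lt) h λ
        { (inj₁ (_ , _ , x , t)) → κ (inj₁ (_ , _ , x , SumR x t))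
        ; (inj₂ (_ , t)) → κ (inj₂ (_ , SumTime s t)) } }
  progressP (suc k) {Γ} (cond b P Q) lt g κ = ¬¬-em {BTrue Γ b} λ
    { (inj₁ y) → κ (inj₁ (_ , _ , sτ , Then y))
    ; (inj₂ n) → κ (inj₁ (_ , _ , sτ , Else n)) }
  progressP (suc k) nil lt g κ = κ (inj₂ (_ , TimeNil))
  progressP (suc k) (fix P) (s≤s lt) g κ =
    progressP k (unfold P) (≤-trans (s≤s (≤-reflexive (burst-unfold P g))) lt) (GuardedP-unfold P g) λ
      { (inj₁ (_ , _ , x , s)) → κ (inj₁ (_ , _ , x , Rec s))
      ; (inj₂ (_ , s)) → κ (inj₂ (_ , Rec s)) }

  -- Well-formedness enters at active receivers, which have no time step on an idle channel.
  progressS : ∀ {Γ W} → WF Γ W → GuardedS W → ¬ ¬ (Moves Γ W ⊎ ∃[ W' ] Step Γ W lσ W')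
  progressS (wproc {P = P}) g κ = progressP _ P ≤-refl g λ
    { (inj₁ m) → κ (inj₁ m)
    ; (inj₂ (_ , s)) → κ (inj₂ (_ , s)) }
  progressS {Γ} (wact {c = c} {P} x) g κ with Γ c in eq
  progressS {Γ} (wact {c = c} {P} ()) g κ | zero , v
  progressS {Γ} (wact {c = c} {P} x) g κ | suc zero , v = κ (inj₂ (_ , EndRcv eq))
  progressS {Γ} (wact {c = c} {P} x) g κ | suc (suc n) , v =
    κ (inj₂ (_ , ActRcv (subst (1 <_) (cong proj₁ (sym eq)) (s≤s (s≤s z≤n)))))
  progressS (wpar {W₁ = V} {W} w₁ w₂) (g , h) κ = progressS w₁ g λ
    { (inj₁ (_ , _ , sτ , s)) → κ (inj₁ (_ , _ , sτ , TauParL s))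
    ; (inj₁ (_ , _ , s! , s)) → receiveS W h λ { (_ , t) → κ (inj₁ (_ , _ , s! , SyncL s t)) }
    ; (inj₂ (_ , s)) → progressS w₂ h λ
      { (inj₁ (_ , _ , sτ , t)) → κ (inj₁ (_ , _ , sτ , TauParR t))
      ; (inj₁ (_ , _ , s! , t)) → receiveS V g λ { (_ , r) → κ (inj₁ (_ , _ , s! , SyncR r t)) }
      ; (inj₂ (_ , t)) → κ (inj₂ (_ , TimePar s t)) } }
  progressS (wnu w) g κ = progressS w g λ
    { (inj₁ (_ , _ , sτ , s)) → κ (inj₁ (_ , _ , sτ , ResV s))
    ; (inj₁ (_ , _ , s! {zero} , s)) → κ (inj₁ (_ , _ , sτ , ResI s))
    ; (inj₁ (_ , _ , s! {suc c} {v} , s)) → κ (inj₁ (_ , _ , s! {c} {v} , ResV s))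
    ; (inj₂ (_ , s)) → κ (inj₂ (_ , ResV s)) }

  -- Contexts, reductions and the passing of time

  infixl 25 _⟪_⟫
  infix 4 _⟶*_

  _⟪_⟫ : Config → Sys → Config
  C ⟪ A ⟫ = proj₁ C , proj₂ C ∥ A

  _⟶*_ : Rel Config 0ℓ
  _⟶*_ = Star _⟶_

  eτ⇒red : ∀ {C D} → C —[ eτ ]→ₑ D → C ⟶ D
  eτ⇒red (Shh s) = red s r!
  eτ⇒red (TauExt s) = red s rτ

  eσ⇒red : ∀ {C D} → C —[ eσ ]→ₑ D → C ⟶ D
  eσ⇒red (Time s) = red s rσ

  red⇒e : ∀ {C D} → C ⟶ D → C —[ eτ ]→ₑ D ⊎ C —[ eσ ]→ₑ D
  red⇒e (red s r!) = inj₁ (Shh s)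
  red⇒e (red s rτ) = inj₁ (TauExt s)
  red⇒e (red s rσ) = inj₂ (Time s)

  ⟹⇒⟶* : ∀ {C D} → C ⟹ₑ D → C ⟶* D
  ⟹⇒⟶* = map eτ⇒red

  preserved : ∀ {T : Rel Config 0ℓ} {P : Config → Set} → (∀ {C D} → P C → T C D → P D) →
              ∀ {C D} → P C → Star T C D → P D
  preserved f p ε = p
  preserved f p (x ◅ xs) = preserved f (f p x) xs

  Tame-red : ∀ {A C D} → Tame A C → C ⟶ D → Tame A D
  Tame-red t (red s _) = Tame-step s t

  Tame-red* : ∀ {A C D} → Tame A C → C ⟶* D → Tame A D
  Tame-red* = preserved Tame-red

  Tame-⟹ : ∀ {A C D} → Tame A C → C ⟹ₑ D → Tame A D
  Tame-⟹ t r = Tame-red* t (⟹⇒⟶* r)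

  Tame-∥ : ∀ {A C W} → Tame A C → Tame A (proj₁ C , W) → Tame A (C ⟪ W ⟫)
  Tame-∥ (tame w g h) (tame w' g' h') = tame (wpar w w') (g , g') (h , h')

  Tame-∥ˡ : ∀ {A C W} → Tame A (C ⟪ W ⟫) → Tame A C
  Tame-∥ˡ (tame (wpar w _) (g , _) (h , _)) = tame w g h

  Fresh : Chan → Config → Set
  Fresh e = Tame (_≢ e)

  -- A bound makes all channels from it upwards fresh at once, which gives every test its own
  -- channel.
  below⇒Fresh : ∀ {d e C} → d ≤ e → Tame (_< d) C → Fresh e C
  below⇒Fresh d≤e = Tame-mono λ c c<d → <⇒≢ (<-≤-trans c<d d≤e)

  Ticks : Rel Config 0ℓ
  Ticks C C' = ∃[ D ] (C ⟹ₑ D × D —[ eσ ]→ₑ C')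

  Ticks⇒⟶* : ∀ {C D} → Ticks C D → C ⟶* D
  Ticks⇒⟶* (_ , r , x) = ⟹⇒⟶* r ◅◅ eσ⇒red x ◅ ε

  -- Each silent step lowers the measure, so at some point progress yields a time step.
  tickWithin : ∀ k {A C} → burstS (proj₂ C) < k → Tame A C → ¬ ¬ (∃[ D ] Ticks C D)
  tickWithin (suc k) (s≤s lt) t κ = progressS (wf t) (legal t) λ
    { (inj₂ (_ , s)) → κ (_ , _ , ε , Time s)
    ; (inj₁ (_ , _ , s! , s)) → tickWithin k (≤-trans (burstS-act (legal t) s! s) lt) (Tame-step s t)
        λ { (_ , _ , r , x) → κ (_ , _ , Shh s ◅ r , x) }
    ; (inj₁ (_ , _ , sτ , s)) → tickWithin k (≤-trans (burstS-act (legal t) sτ s) lt) (Tame-step s t)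
        λ { (_ , _ , r , x) → κ (_ , _ , TauExt s ◅ r , x) } }

  tick : ∀ {A C} → Tame A C → ¬ ¬ (∃[ D ] Ticks C D)
  tick = tickWithin _ ≤-refl

  -- Silence and beacons

  -- Silent steps change the state of a channel only by a broadcast on it, which freshness excludes.
  Fresh-eτ-env : ∀ {e C D} → Fresh e C → C —[ eτ ]→ₑ D → proj₁ D e ≡ proj₁ C e
  Fresh-eτ-env {e} {Γ , W} t (Shh s) = upd-other Γ _ _ λ { refl → ChS-send s (chans t) refl }
  Fresh-eτ-env t (TauExt s) = refl

  Fresh-⟹-env : ∀ {e C D} → Fresh e C → C ⟹ₑ D → proj₁ D e ≡ proj₁ C e
  Fresh-⟹-env t ε = refl
  Fresh-⟹-env t (x ◅ r) = trans (Fresh-⟹-env (Tame-red t (eτ⇒red x)) r) (Fresh-eτ-env t x)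

  -- Nothing can prolong the transmission on a fresh channel, and each tick lowers its timer by one.
  run-to-idle : ∀ n {e C} → Fresh e C → proj₁ (proj₁ C e) ≡ n → ¬ ¬ (∃[ D ] (C ⟶* D × Idle (proj₁ D) e))
  run-to-idle zero t eq κ = κ (_ , ε , eq)
  run-to-idle (suc n) {e} t eq κ = tick t λ
    { (_ , _ , r , Time s) →
      run-to-idle n (Tame-step s (Tame-⟹ t r))
        (cong (_∸ 1) (trans (cong proj₁ (Fresh-⟹-env t r)) eq))
        λ { (_ , r' , i) → κ (_ , ⟹⇒⟶* r ◅◅ red s rσ ◅ r' , i) } }

  IdleFresh : Chan → Config → Set
  IdleFresh e C = Fresh e C × Idle (proj₁ C) e

  IdleFresh-red : ∀ {e C D} → IdleFresh e C → C ⟶ D → IdleFresh e D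
  IdleFresh-red {e} {C} {D} (t , i) x = Tame-red t x , idle (red⇒e x)
    where
    idle : C —[ eτ ]→ₑ D ⊎ C —[ eσ ]→ₑ D → Idle (proj₁ D) e
    idle (inj₁ y) = trans (cong proj₁ (Fresh-eτ-env t y)) i
    idle (inj₂ (Time _)) = cong (_∸ 1) i

  IdleFresh-no-barb : ∀ {e C} → IdleFresh e C → ¬ (C ⇓ e)
  IdleFresh-no-barb h (D , r , x) with preserved IdleFresh-red h r
  ... | _ , i = <-irrefl (sym i) x

  beacon : ∀ {n m} → Chan → Proc n m
  beacon e = fix (snd e (val err) (pvar zero))

  -- The index is the number of time units until the next broadcast.  The
  -- unfolded form arises from an ignored input below a recursion.
  data Beaconing (e : Chan) : ℕ → Proc 0 0 → Set where
    folded   : Beaconing e 0 (beacon e)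
    unfolded : Beaconing e 0 (snd e (val err) (beacon e))
    asleep   : ∀ {j P} → Beaconing e j P → Beaconing e (suc j) (slp P)

  -- By the inequality in `here` the beacon wakes no later than the current transmission ends, so it
  -- can broadcast whenever `e` is idle. The other components do not use `e` and ignore the
  -- broadcast.
  data Loud (e : Chan) (Γ : Env) : Sys → Set where
    here : ∀ {j P} → j ≤ proj₁ (Γ e) → Beaconing e j P → Loud e Γ (proc P)
    inL  : ∀ {V W} → Loud e Γ V → ChS (_≢ e) W → Loud e Γ (V ∥ W)
    inR  : ∀ {V W} → ChS (_≢ e) V → Loud e Γ W → Loud e Γ (V ∥ W)

  LoudC : Chan → Config → Set
  LoudC e C = Loud e (proj₁ C) (proj₂ C)

  Beaconing-sleeps : ∀ {e} k → Beaconing e k (sleeps k (beacon e))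
  Beaconing-sleeps zero = folded
  Beaconing-sleeps (suc k) = asleep (Beaconing-sleeps k)

  Beaconing-step : ∀ {e Γ j P l W} → j ≤ proj₁ (Γ e) → Beaconing e j P → Step Γ (proc P) l W → Loud e (applyL l Γ) W
  Beaconing-step x folded (RcvIgn _) = here z≤n folded
  Beaconing-step x folded (Rec s) = Beaconing-step x unfolded s
  Beaconing-step x unfolded (RcvIgn _) = here z≤n unfolded
  -- The beacon sleeps for `δ err` units, and the timer is at least that, also if `e` was already
  -- exposed.
  Beaconing-step {e} {Γ} x unfolded Snd = here (δ≤sndEnv Γ e err) (Beaconing-sleeps (δ err))
  Beaconing-step {e} {Γ} x (asleep b) (RcvIgn {c = c} {v} _) = here (≤-trans x (sndEnv-mono Γ c v e)) (asleep b)
  Beaconing-step x (asleep b) Sleep = here (∸-monoˡ-≤ 1 x) b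

  Loud-step : ∀ {e Γ W l W'} → Loud e Γ W → Step Γ W l W' → Loud e (applyL l Γ) W'
  Loud-step (here x b) s = Beaconing-step x b s
  Loud-step (inL b f) (RcvIgn n) = inL (Loud-step b (RcvIgn λ { (i , r) → n (i , rparL r) })) f
  Loud-step (inL b f) (SyncL s t) = inL (Loud-step b s) (ChS-step t f)
  Loud-step (inL b f) (SyncR s t) = inL (Loud-step b s) (ChS-step t f)
  Loud-step (inL b f) (RcvPar s t) = inL (Loud-step b s) (ChS-step t f)
  Loud-step (inL b f) (TimePar s t) = inL (Loud-step b s) (ChS-step t f)
  Loud-step (inL b f) (TauParL s) = inL (Loud-step b s) f
  Loud-step (inL b f) (TauParR s) = inL b (ChS-step s f)
  Loud-step (inR f b) (RcvIgn n) = inR f (Loud-step b (RcvIgn λ { (i , r) → n (i , rparR r) }))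
  Loud-step (inR f b) (SyncL s t) = inR (ChS-step s f) (Loud-step b t)
  Loud-step (inR f b) (SyncR s t) = inR (ChS-step s f) (Loud-step b t)
  Loud-step (inR f b) (RcvPar s t) = inR (ChS-step s f) (Loud-step b t)
  Loud-step (inR f b) (TimePar s t) = inR (ChS-step s f) (Loud-step b t)
  Loud-step (inR f b) (TauParL s) = inR (ChS-step s f) b
  Loud-step (inR f b) (TauParR s) = inR f (Loud-step b s)

  Loud-red : ∀ {e C D} → LoudC e C → C ⟶ D → LoudC e D
  Loud-red b (red s _) = Loud-step b s

  fresh-ignores : ∀ {e Γ v} W → ChS (_≢ e) W → Step Γ W (l? e v) W
  fresh-ignores W f = RcvIgn λ { (_ , r) → ChS-rcv r f refl }

  Loud-send : ∀ {e Γ W} → Loud e Γ W → Idle Γ e → ∃[ W' ] Step Γ W (l! e err) W'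
  Loud-send (here x folded) i = _ , Rec Snd
  Loud-send (here x unfolded) i = _ , Snd
  Loud-send (here x (asleep b)) i = ⊥-elim (<-irrefl (sym i) (≤-trans (s≤s z≤n) x))
  Loud-send (inL {W = W} b f) i = _ , SyncL (proj₂ (Loud-send b i)) (fresh-ignores W f)
  Loud-send (inR {V = V} f b) i = _ , SyncR (fresh-ignores V f) (proj₂ (Loud-send b i))

  Loud-barb : ∀ {e C} → LoudC e C → C ⇓ e
  Loud-barb {e} {Γ , W} b with proj₁ (Γ e) in eq
  ... | suc n = _ , ε , subst (1 ≤_) (sym eq) (s≤s z≤n)
  ... | zero = _ , red (proj₂ (Loud-send b eq)) r! ◅ ε , sndEnv-exposed Γ e err

  -- Doubly negated because the way to a loud state may need a time step.
  CanBeLoud : Chan → Config → Set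
  CanBeLoud e C = ¬ ¬ (∃[ D ] (C ⟶* D × LoudC e D))

  -- Parallel components

  -- Inversion of transitions of a composition; an input ignored by the whole is split into inputs
  -- ignored by both components.
  data ParStep (Γ : Env) (V W : Sys) : Label → Sys → Set where
    sendL : ∀ {c v V' W'} → Step Γ V (l! c v) V' → Step Γ W (l? c v) W' → ParStep Γ V W (l! c v) (V' ∥ W')
    sendR : ∀ {c v V' W'} → Step Γ V (l? c v) V' → Step Γ W (l! c v) W' → ParStep Γ V W (l! c v) (V' ∥ W')
    recv  : ∀ {c v V' W'} → Step Γ V (l? c v) V' → Step Γ W (l? c v) W' → ParStep Γ V W (l? c v) (V' ∥ W')
    time  : ∀ {V' W'} → Step Γ V lσ V' → Step Γ W lσ W' → ParStep Γ V W lσ (V' ∥ W')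
    tauL  : ∀ {V'} → Step Γ V lτ V' → ParStep Γ V W lτ (V' ∥ W)
    tauR  : ∀ {W'} → Step Γ W lτ W' → ParStep Γ V W lτ (V ∥ W')

  parStep : ∀ {Γ V W l X} → Step Γ (V ∥ W) l X → ParStep Γ V W l X
  parStep (RcvIgn n) = recv (RcvIgn λ { (i , r) → n (i , rparL r) }) (RcvIgn λ { (i , r) → n (i , rparR r) })
  parStep (SyncL s t) = sendL s t
  parStep (SyncR s t) = sendR s t
  parStep (RcvPar s t) = recv s t
  parStep (TimePar s t) = time s t
  parStep (TauParL s) = tauL s
  parStep (TauParR s) = tauR s

  -- Broadcasts of the tested system pass a deaf test without changing it, so the state of the test
  -- is known throughout a run.
  record Deaf (A : Sys) : Set where
    constructor deaf
    field
      no-rcv : ∀ c → ¬ RcvS A c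
      still  : ∀ {Γ c v A'} → Step Γ A (l? c v) A' → A' ≡ A
  open Deaf

  lift-eτ : ∀ {A C D} → (∀ c → ¬ RcvS A c) → C —[ eτ ]→ₑ D → C ⟪ A ⟫ —[ eτ ]→ₑ D ⟪ A ⟫
  lift-eτ n (Shh s) = Shh (SyncL s (RcvIgn λ { (_ , r) → n _ r }))
  lift-eτ n (TauExt s) = TauExt (TauParL s)

  lift-⟹ : ∀ {A C D} → (∀ c → ¬ RcvS A c) → C ⟹ₑ D → C ⟪ A ⟫ ⟹ₑ D ⟪ A ⟫
  lift-⟹ {A} n = gmap (_⟪ A ⟫) (lift-eτ n)

  lift-tick : ∀ {A A' C D} → (∀ c → ¬ RcvS A c) → (∀ {Γ} → Step Γ A lσ A') → Ticks C D → Ticks (C ⟪ A ⟫) (D ⟪ A' ⟫)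
  lift-tick n a (_ , r , Time s) = _ , lift-⟹ n r , Time (TimePar s a)

  data Joint (C : Config) (A : Sys) : Config → Set where
    env  : ∀ {D} → C —[ eτ ]→ₑ D → Joint C A (D ⟪ A ⟫)
    own  : ∀ {A'} → Step (proj₁ C) A lτ A' → Joint C A (C ⟪ A' ⟫)
    talk : ∀ {W c v A'} → Step (proj₁ C) (proj₂ C) (l? c v) W → Step (proj₁ C) A (l! c v) A' →
           Joint C A ((sndEnv c v (proj₁ C) , W) ⟪ A' ⟫)

  joint : ∀ {A C D} → Deaf A → C ⟪ A ⟫ —[ eτ ]→ₑ D → Joint C A D
  joint f (Shh s) with parStep s
  ... | sendL s₁ s₂ rewrite still f s₂ = env (Shh s₁)
  ... | sendR s₁ s₂ = talk s₁ s₂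
  joint f (TauExt s) with parStep s
  ... | tauL s₁ = env (TauExt s₁)
  ... | tauR s₂ = own s₂

  -- Locks and delayed locks

  lock : Chan → Proc 0 0
  lock d = tau nil ⊕ tau (beacon d)

  deaf-nil : Deaf (proc nil)
  deaf-nil = deaf (λ { _ (rproc ()) }) λ { (RcvIgn _) → refl }

  deaf-slp : ∀ {P} → Deaf (proc (slp P))
  deaf-slp = deaf (λ { _ (rproc ()) }) λ { (RcvIgn _) → refl }

  deaf-act : ∀ {c P} → Deaf (act c P)
  deaf-act = deaf (λ { _ () }) λ { (RcvIgn _) → refl }

  deaf-sum : ∀ {P Q} → (∀ c → ¬ RcvP P c) → (∀ c → ¬ RcvP Q c) → Deaf (proc (P ⊕ Q))
  deaf-sum p q = deaf (λ { _ (rproc (rsumL r)) → p _ r ; _ (rproc (rsumR r)) → q _ r }) λ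
    { (RcvIgn _) → refl
    ; (SumRcvL _ (_ , rproc r)) → ⊥-elim (p _ r)
    ; (SumRcvR _ (_ , rproc r)) → ⊥-elim (q _ r) }

  deaf-lock : ∀ {d} → Deaf (proc (lock d))
  deaf-lock = deaf-sum (λ _ ()) (λ _ ())

  lock-dies : ∀ {d C} → C ⟪ proc (lock d) ⟫ ⟶ C ⟪ proc nil ⟫
  lock-dies = red (TauParR (SumL sτ Tau)) rτ

  lock-beacons : ∀ {d C} → C ⟪ proc (lock d) ⟫ ⟶ C ⟪ proc (beacon d) ⟫
  lock-beacons = red (TauParR (SumR sτ Tau)) rτ

  lock-tame : ∀ {A : Chan → Set} {Γ} d → A d → Tame A (Γ , proc (lock d))
  lock-tame d a = tame wproc (tt , (λ ()) , tt) (tt , a , tt)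

  nil-tame : ∀ {A Γ} → Tame A (Γ , proc nil)
  nil-tame = tame wproc tt tt

  beacon-loud : ∀ {e C} → Fresh e C → LoudC e (C ⟪ proc (beacon e) ⟫)
  beacon-loud t = inR (chans t) (here z≤n folded)

  lock-canBeLoud : ∀ {e C} → Fresh e C → CanBeLoud e (C ⟪ proc (lock e) ⟫)
  lock-canBeLoud t κ = κ (_ , lock-beacons ◅ ε , beacon-loud t)

  -- While the lock lives only silent steps are possible; a dead one admits arbitrary reductions,
  -- including time. A loud state needs no record of its past.
  data LockRun (d : Chan) (C : Config) : Config → Set where
    live : ∀ {D} → C ⟹ₑ D → LockRun d C (D ⟪ proc (lock d) ⟫)
    dead : ∀ {D} → C ⟶* D → LockRun d C (D ⟪ proc nil ⟫)
    loud : ∀ {X} → LoudC d X → LockRun d C X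

  -- A sum lets time pass only if both summands do, and τ-prefixes do not.
  lock-no-time : ∀ {d C X} {Y : Set} → C ⟪ proc (lock d) ⟫ —[ eσ ]→ₑ X → Y
  lock-no-time (Time s) with parStep s
  ... | time _ (SumTime () _)

  dead-red : ∀ {C X} → C ⟪ proc nil ⟫ ⟶ X → ∃[ D ] (C ⟶ D × X ≡ D ⟪ proc nil ⟫)
  dead-red x with red⇒e x
  dead-red x | inj₁ y with joint deaf-nil y
  ... | env z = _ , eτ⇒red z , refl
  dead-red x | inj₂ (Time s) with parStep s
  ... | time s₁ TimeNil = _ , red s₁ rσ , refl

  lockRun-red : ∀ {d C X Y} → Fresh d C → LockRun d C X → X ⟶ Y → LockRun d C Y
  lockRun-red t (live r) x with red⇒e x
  ... | inj₂ y = lock-no-time y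
  ... | inj₁ y with joint deaf-lock y
  ... | env z = live (r ◅◅ z ◅ ε)
  ... | own (SumL sτ Tau) = dead (⟹⇒⟶* r)
  ... | own (SumR sτ Tau) = loud (beacon-loud (Tame-⟹ t r))
  ... | talk _ (SumL s! ())
  ... | talk _ (SumR s! ())
  lockRun-red t (dead r) x with dead-red x
  ... | _ , y , refl = dead (r ◅◅ y ◅ ε)
  lockRun-red t (loud b) x = loud (Loud-red b x)

  lockRun : ∀ {d C X} → Fresh d C → C ⟪ proc (lock d) ⟫ ⟶* X → LockRun d C X
  lockRun t = preserved (lockRun-red t) (live ε)

  data Resolved (d : Chan) : Config → Set where
    dead : ∀ {D} → Fresh d D → Resolved d (D ⟪ proc nil ⟫)
    loud : ∀ {X} → LoudC d X → Resolved d X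

  resolved-red : ∀ {d X Y} → Resolved d X → X ⟶ Y → Resolved d Y
  resolved-red (dead t) x with dead-red x
  ... | _ , y , refl = dead (Tame-red t y)
  resolved-red (loud b) x = loud (Loud-red b x)

  time-resolves : ∀ {d C X Y} → Fresh d C → LockRun d C X → X —[ eσ ]→ₑ Y → Resolved d Y
  time-resolves t (live r) x = lock-no-time x
  time-resolves t (dead r) x = resolved-red (dead (Tame-red* t r)) (eσ⇒red x)
  time-resolves t (loud b) x = loud (Loud-red b (eσ⇒red x))

  -- The delayed lock wakes at the first tick and then blocks time, so a live one witnesses exactly
  -- one tick of `C`.
  data DelayedRun (d : Chan) (C : Config) : Config → Set where
    lag   : ∀ {D} → C ⟹ₑ D → DelayedRun d C (D ⟪ proc (slp (lock d)) ⟫)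
    awake : ∀ {D X} → Ticks C D → LockRun d D X → DelayedRun d C X

  delayedRun-red : ∀ {d C X Y} → Fresh d C → DelayedRun d C X → X ⟶ Y → DelayedRun d C Y
  delayedRun-red t (lag r) x with red⇒e x
  delayedRun-red t (lag r) x | inj₁ y with joint deaf-slp y
  ... | env z = lag (r ◅◅ z ◅ ε)
  delayedRun-red t (lag r) x | inj₂ (Time s) with parStep s
  ... | time s₁ Sleep = awake (_ , r , Time s₁) (live ε)
  delayedRun-red t (awake k r) x = awake k (lockRun-red (Tame-red* t (Ticks⇒⟶* k)) r x)

  delayedRun : ∀ {d C X} → Fresh d C → C ⟪ proc (slp (lock d)) ⟫ ⟶* X → DelayedRun d C X
  delayedRun t = preserved (delayedRun-red t) (lag ε)

  -- Gates, shots and inert remainders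

  gate : BExp 0 → Proc 0 0 → Proc 0 0 → Chan → Proc 0 0
  gate b P Q e = cond b P Q ⊕ tau (beacon e)

  deaf-gate : ∀ {b P Q e} → Deaf (proc (gate b P Q e))
  deaf-gate = deaf-sum (λ _ ()) (λ _ ())

  -- `D` is the state in which the condition was evaluated. An undecided gate can still become a
  -- beacon, which tells it apart from one that has succeeded.
  data GateRun (b : BExp 0) (P Q : Proc 0 0) (e : Chan) (C : Config) : Config → Set where
    closed : ∀ {D} → C ⟹ₑ D → GateRun b P Q e C (D ⟪ proc (gate b P Q e) ⟫)
    true   : ∀ {D D'} → C ⟹ₑ D → BTrue (proj₁ D) b → D ⟹ₑ D' → GateRun b P Q e C (D' ⟪ proc (slp P) ⟫)
    false  : ∀ {D D'} → C ⟹ₑ D → ¬ BTrue (proj₁ D) b → D ⟹ₑ D' → GateRun b P Q e C (D' ⟪ proc (slp Q) ⟫)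
    loud   : ∀ {X} → LoudC e X → GateRun b P Q e C X

  gateRun-eτ : ∀ {b P Q e C X Y} → Fresh e C → GateRun b P Q e C X → X —[ eτ ]→ₑ Y → GateRun b P Q e C Y
  gateRun-eτ t (closed r) y with joint deaf-gate y
  ... | env z = closed (r ◅◅ z ◅ ε)
  ... | own (SumL sτ (Then x)) = true r x ε
  ... | own (SumL sτ (Else x)) = false r x ε
  ... | own (SumR sτ Tau) = loud (beacon-loud (Tame-⟹ t r))
  ... | talk _ (SumL s! ())
  ... | talk _ (SumR s! ())
  gateRun-eτ t (true r x r') y with joint deaf-slp y
  ... | env z = true r x (r' ◅◅ z ◅ ε)
  gateRun-eτ t (false r x r') y with joint deaf-slp y
  ... | env z = false r x (r' ◅◅ z ◅ ε)
  gateRun-eτ t (loud b) y = loud (Loud-red b (eτ⇒red y))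

  gateRun : ∀ {b P Q e C X} → Fresh e C → C ⟪ proc (gate b P Q e) ⟫ ⟹ₑ X → GateRun b P Q e C X
  gateRun t = preserved (gateRun-eτ t) (closed ε)

  -- What a successful test leaves behind; as it merely lets time pass, it can be discarded.
  data Inert : Sys → Set where
    stopped : Inert (proc nil)
    delayed : ∀ {P} → Inert (proc P) → Inert (proc (slp P))

  inert-sleeps : ∀ k → Inert (proc (sleeps k nil))
  inert-sleeps zero = stopped
  inert-sleeps (suc k) = delayed (inert-sleeps k)

  inert-deaf : ∀ {I} → Inert I → Deaf I
  inert-deaf stopped = deaf-nil
  inert-deaf (delayed _) = deaf-slp

  inert-time : ∀ {I} → Inert I → ∃[ I' ] (Inert I' × ∀ {Γ} → Step Γ I lσ I')
  inert-time stopped = _ , stopped , TimeNil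
  inert-time (delayed i) = _ , i , Sleep

  inert-σ : ∀ {Γ I I'} → Inert I → Step Γ I lσ I' → Inert I'
  inert-σ stopped TimeNil = stopped
  inert-σ (delayed i) Sleep = i

  inert-idle : ∀ {Γ I l I'} {Y : Set} → Inert I → SumLab l → Step Γ I l I' → Y
  inert-idle stopped sτ ()
  inert-idle stopped s! ()
  inert-idle (delayed _) sτ ()
  inert-idle (delayed _) s! ()

  -- The broadcast happens only together with an input of the tested system; the other summand makes
  -- an unfired shot visible.
  shot : Chan → Val → Chan → Proc 0 0
  shot c v e = snd c (val v) nil ⊕ tau (beacon e)

  deaf-shot : ∀ {c v e} → Deaf (proc (shot c v e))
  deaf-shot = deaf-sum (λ _ ()) (λ _ ())

  data ShotRun (c : Chan) (v : Val) (e : Chan) (C : Config) : Config → Set where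
    unfired : ∀ {D} → C ⟹ₑ D → ShotRun c v e C (D ⟪ proc (shot c v e) ⟫)
    fired   : ∀ {D E D'} → C ⟹ₑ D → D —[ e? c v ]→ₑ E → E ⟹ₑ D' →
              ShotRun c v e C (D' ⟪ proc (sleeps (δ v) nil) ⟫)
    loud    : ∀ {X} → LoudC e X → ShotRun c v e C X

  shotRun-eτ : ∀ {c v e C X Y} → Fresh e C → ShotRun c v e C X → X —[ eτ ]→ₑ Y → ShotRun c v e C Y
  shotRun-eτ t (unfired r) y with joint deaf-shot y
  ... | env z = unfired (r ◅◅ z ◅ ε)
  ... | own (SumL sτ ())
  ... | own (SumR sτ Tau) = loud (beacon-loud (Tame-⟹ t r))
  ... | talk s (SumL s! Snd) = fired r (Input s) ε
  ... | talk _ (SumR s! ())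
  shotRun-eτ {v = v} t (fired r x r') y with joint (inert-deaf (inert-sleeps (δ v))) y
  ... | env z = fired r x (r' ◅◅ z ◅ ε)
  ... | own s = inert-idle (inert-sleeps (δ v)) sτ s
  ... | talk _ s = inert-idle (inert-sleeps (δ v)) s! s
  shotRun-eτ t (loud b) y = loud (Loud-red b (eτ⇒red y))

  shotRun : ∀ {c v e C X} → Fresh e C → C ⟪ proc (shot c v e) ⟫ ⟹ₑ X → ShotRun c v e C X
  shotRun t = preserved (shotRun-eτ t) (unfired ε)

  act-run : ∀ {c P C X} → C ⟪ act c P ⟫ ⟹ₑ X → ∃[ D ] (C ⟹ₑ D × X ≡ D ⟪ act c P ⟫)
  act-run {c} {P} {C} = preserved step (_ , ε , refl)
    where
    step : ∀ {X Y} → ∃[ D ] (C ⟹ₑ D × X ≡ D ⟪ act c P ⟫) → X —[ eτ ]→ₑ Y → ∃[ D ] (C ⟹ₑ D × Y ≡ D ⟪ act c P ⟫)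
    step (_ , r , refl) y with joint deaf-act y
    ... | env z = _ , r ◅◅ z ◅ ε , refl

  -- Structural congruence

  -- Exchanging the two outermost tests and discarding inert ones is all that the matching needs.
  data _≅_ : Sys → Sys → Set where
    ≅-refl  : ∀ {V} → V ≅ V
    ≅-trans : ∀ {V W X} → V ≅ W → W ≅ X → V ≅ X
    ≅-cong  : ∀ {V W X} → V ≅ W → (V ∥ X) ≅ (W ∥ X)
    drop    : ∀ {V I} → Inert I → (V ∥ I) ≅ V
    add     : ∀ {V I} → Inert I → V ≅ (V ∥ I)
    swap    : ∀ {V W X} → ((V ∥ W) ∥ X) ≅ ((V ∥ X) ∥ W)

  ≅-sym : ∀ {V W} → V ≅ W → W ≅ V
  ≅-sym ≅-refl = ≅-refl
  ≅-sym (≅-trans p q) = ≅-trans (≅-sym q) (≅-sym p)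
  ≅-sym (≅-cong p) = ≅-cong (≅-sym p)
  ≅-sym (drop i) = add i
  ≅-sym (add i) = drop i
  ≅-sym swap = swap

  swap-step : ∀ {Γ V W X l Y} → Step Γ ((V ∥ W) ∥ X) l Y → ∃[ Y' ] (Step Γ ((V ∥ X) ∥ W) l Y' × Y ≅ Y')
  swap-step s with parStep s
  swap-step s | sendL s₁ x with parStep s₁
  ... | sendL v w = _ , SyncL (SyncL v x) w , swap
  ... | sendR v w = _ , SyncR (RcvPar v x) w , swap
  swap-step s | sendR s₁ x with parStep s₁
  ... | recv v w = _ , SyncL (SyncR v x) w , swap
  swap-step s | recv s₁ x with parStep s₁
  ... | recv v w = _ , RcvPar (RcvPar v x) w , swap
  swap-step s | time s₁ x with parStep s₁
  ... | time v w = _ , TimePar (TimePar v x) w , swap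
  swap-step s | tauL s₁ with parStep s₁
  ... | tauL v = _ , TauParL (TauParL v) , swap
  ... | tauR w = _ , TauParR w , swap
  swap-step s | tauR x = _ , TauParL (TauParR x) , swap

  drop-step : ∀ {Γ V I l Y} → Inert I → Step Γ (V ∥ I) l Y → ∃[ Y' ] (Step Γ V l Y' × Y ≅ Y')
  drop-step i s with parStep s
  ... | sendL v x rewrite still (inert-deaf i) x = _ , v , drop i
  ... | sendR v x = inert-idle i s! x
  ... | recv v x rewrite still (inert-deaf i) x = _ , v , drop i
  ... | time v x = _ , v , drop (inert-σ i x)
  ... | tauL v = _ , v , drop i
  ... | tauR x = inert-idle i sτ x

  add-step : ∀ {Γ V I l Y} → Inert I → Step Γ V l Y → ∃[ Y' ] (Step Γ (V ∥ I) l Y' × Y ≅ Y')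
  add-step {l = l! c v} i s = _ , SyncL s (RcvIgn λ { (_ , r) → no-rcv (inert-deaf i) _ r }) , add i
  add-step {l = l? c v} i s = _ , RcvPar s (RcvIgn λ { (_ , r) → no-rcv (inert-deaf i) _ r }) , add i
  add-step {l = lσ} i s with inert-time i
  ... | _ , i' , t = _ , TimePar s t , add i'
  add-step {l = lτ} i s = _ , TauParL s , add i

  ≅-step : ∀ {Γ V W l V'} → V ≅ W → Step Γ V l V' → ∃[ W' ] (Step Γ W l W' × V' ≅ W')
  ≅-step ≅-refl s = _ , s , ≅-refl
  ≅-step (≅-trans p q) s with ≅-step p s
  ... | _ , t , p' with ≅-step q t
  ... | _ , u , q' = _ , u , ≅-trans p' q'
  ≅-step (≅-cong p) s with parStep s
  ... | sendL v x = let _ , w , p' = ≅-step p v in _ , SyncL w x , ≅-cong p'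
  ... | sendR v x = let _ , w , p' = ≅-step p v in _ , SyncR w x , ≅-cong p'
  ... | recv v x = let _ , w , p' = ≅-step p v in _ , RcvPar w x , ≅-cong p'
  ... | time v x = let _ , w , p' = ≅-step p v in _ , TimePar w x , ≅-cong p'
  ... | tauL v = let _ , w , p' = ≅-step p v in _ , TauParL w , ≅-cong p'
  ... | tauR x = _ , TauParR x , ≅-cong p
  ≅-step (drop i) s = drop-step i s
  ≅-step (add i) s = add-step i s
  ≅-step swap s = swap-step s

  ≅-red* : ∀ {Γ V W D} → V ≅ W → (Γ , V) ⟶* D → ∃[ W' ] ((Γ , W) ⟶* (proj₁ D , W') × proj₂ D ≅ W')
  ≅-red* p ε = _ , ε , p
  ≅-red* p (red s x ◅ r) with ≅-step p s
  ... | _ , t , p' with ≅-red* p' r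
  ... | _ , r' , p'' = _ , red t x ◅ r' , p''

  ≅-barb : ∀ {Γ V W c} → V ≅ W → (Γ , V) ⇓ c → (Γ , W) ⇓ c
  ≅-barb p (_ , r , x) with ≅-red* p r
  ... | _ , r' , _ = _ , r' , x

  record UpTo≅ (R : Rel Config 0ℓ) (C D : Config) : Set where
    constructor upTo
    field
      {V W} : Sys
      left : V ≅ proj₂ C
      right : W ≅ proj₂ D
      related : R (proj₁ C , V) (proj₁ D , W)

  red*-closed : ∀ {R} → IsRBC R → ∀ {C D C'} → R C D → C ⟶* C' → ∃[ D' ] (D ⟶* D' × R C' D')
  red*-closed rbc p ε = _ , ε , p
  red*-closed rbc p (x ◅ r) with IsRBC.redClosed rbc p x
  ... | _ , s , q with red*-closed rbc q r
  ... | _ , s' , q' = _ , s ◅◅ s' , q'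

  -- As `≅` is a strong bisimulation over equal environments and is preserved by parallel contexts,
  -- all conditions carry over to the closure, in which finished tests may be discarded.
  upTo≅-isRBC : ∀ {R} → IsRBC R → IsRBC (UpTo≅ R)
  upTo≅-isRBC {R} rbc = record
    { symm = λ { (upTo p q r) → upTo q p (symm r) }
    ; barbs = λ { (upTo p q r) b → ≅-barb q (barbs r (≅-barb (≅-sym p) b)) }
    ; redClosed = redClosed≅
    ; contextual = λ { (upTo p q r) W g → upTo (≅-cong p) (≅-cong q) (contextual r W g) }
    }
    where
    open IsRBC rbc
    redClosed≅ : ∀ {C D C'} → UpTo≅ R C D → C ⟶ C' → ∃[ D' ] (D ⟶* D' × UpTo≅ R C' D')
    redClosed≅ (upTo p q r) x with ≅-red* (≅-sym p) (x ◅ ε)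
    ... | _ , x' , p' with red*-closed rbc r x'
    ... | _ , y , r' with ≅-red* q y
    ... | _ , y' , q' = _ , y' , upTo (≅-sym p') q' r'

  -- Exposure and reachable beacons in tested configurations

  ⟹-⊑ : ∀ {C D} → C ⟹ₑ D → proj₁ C ⊑ proj₁ D
  ⟹-⊑ ε c x = x
  ⟹-⊑ {Γ , _} (Shh {c = d} {v} s ◅ r) c x = ⟹-⊑ r c (sndEnv-⊑ Γ d v c x)
  ⟹-⊑ (TauExt s ◅ r) c x = ⟹-⊑ r c x

  lock-chans : ∀ {d e} → d ≢ e → ChS (_≢ e) (proc (lock d))
  lock-chans d≢e = tt , d≢e , tt

  gate-canBeLoud : ∀ {b P Q d e C} → d ≢ e → Fresh e C → CanBeLoud e (C ⟪ proc (gate b P Q e) ⟫ ⟪ proc (lock d) ⟫)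
  gate-canBeLoud d≢e t κ =
    κ (_ , red (TauParL (TauParR (SumR sτ Tau))) rτ ◅ ε , inL (beacon-loud t) (lock-chans d≢e))

  shot-canBeLoud : ∀ {c v d e C} → d ≢ e → Fresh e C → CanBeLoud e (C ⟪ proc (shot c v e) ⟫ ⟪ proc (lock d) ⟫)
  shot-canBeLoud d≢e t κ =
    κ (_ , red (TauParL (TauParR (SumR sτ Tau))) rτ ◅ ε , inL (beacon-loud t) (lock-chans d≢e))

  -- The lock must die first, as it blocks time; then a tick wakes the beacon.
  slp-canBeLoud : ∀ {d e C} → Fresh e C → CanBeLoud e (C ⟪ proc (slp (beacon e)) ⟫ ⟪ proc (lock d) ⟫)
  slp-canBeLoud t κ = tick t λ
    { (_ , k) → κ (_ , lock-dies ◅ Ticks⇒⟶* (lift-tick (no-rcv deaf-nil) TimeNil (lift-tick (no-rcv deaf-slp) Sleep k))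
                     , inL (beacon-loud (Tame-red* t (Ticks⇒⟶* k))) tt) }

  loud-canBeLoud : ∀ {d e C} → d ≢ e → LoudC e C → CanBeLoud e (C ⟪ proc (lock d) ⟫)
  loud-canBeLoud d≢e b κ = κ (_ , ε , inL b (lock-chans d≢e))

  -- A receiver that does not finish at the tick had a timer above one, which leaves `c` exposed
  -- afterwards.
  act-tick : ∀ {c P C E} → Ticks (C ⟪ act c P ⟫) E →
             Exposed (proj₁ E) c ⊎
             ∃[ D ] ∃[ W ] ∃[ w ] (C ⟹ₑ D × proj₁ D c ≡ (1 , w) × Step (proj₁ D) (proj₂ D) lσ W ×
                                   E ≡ (σEnv (proj₁ D) , W) ⟪ proc (P [ w ]) ⟫)
  act-tick (_ , r , Time s) with act-run r
  ... | _ , y , refl with parStep s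
  ... | time t (ActRcv x) = inj₁ (∸-monoˡ-≤ 1 x)
  ... | time t (EndRcv q) = inj₂ (_ , _ , _ , y , q , t , refl)

  -- Locked congruence: matching of silent and time steps

  module Matching (R₀ : Rel Config 0ℓ) (rbc₀ : IsRBC R₀) where

    R : Rel Config 0ℓ
    R = UpTo≅ R₀

    rbc : IsRBC R
    rbc = upTo≅-isRBC rbc₀

    open IsRBC rbc

    reshape : ∀ {Γ Δ V V' W W'} → V ≅ V' → W ≅ W' → R (Γ , V) (Δ , W) → R (Γ , V') (Δ , W')
    reshape p q (upTo a b r) = upTo (≅-trans a p) (≅-trans b q) r

    -- The left side can reach a state that never shows `e` again; its match on the right is still
    -- loud and has the barb.
    clash-loud : ∀ {e C D} → R C D → Fresh e C → LoudC e D → ⊥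
    clash-loud r t b = run-to-idle _ t refl λ
      { (_ , x , i) → let _ , y , r' = red*-closed rbc r x in
        IdleFresh-no-barb (Tame-red* t x , i) (barbs (symm r') (Loud-barb (preserved Loud-red b y))) }

    clash : ∀ {e C D} → R C D → Fresh e C → CanBeLoud e D → ⊥
    clash r t k = k λ
      { (_ , y , b) → let _ , x , r' = red*-closed rbc (symm r) y in
        clash-loud (symm r') (Tame-red* t x) b }

    -- Against a dead lock the left one can still beacon; against a beacon it can die and leave `d`
    -- silent.
    unresolved : ∀ {d C X} → Fresh d C → R (C ⟪ proc (lock d) ⟫) X → ¬ Resolved d X
    unresolved t r (dead u) = clash (symm r) (Tame-∥ u nil-tame) (lock-canBeLoud t)
    unresolved t r (loud b) with redClosed r lock-dies
    ... | _ , x , r' = clash-loud r' (Tame-∥ t nil-tame) (preserved Loud-red b x)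

    -- Death of the left lock is matched only by death of the right one, as a live lock may still
    -- beacon. The reductions of `D` may include time.
    unlock : ∀ {d C D} → Fresh d C → Fresh d D → R (C ⟪ proc (lock d) ⟫) (D ⟪ proc (lock d) ⟫) →
             ∃[ D' ] (D ⟶* D' × R C D')
    unlock t u r with redClosed r lock-dies
    ... | _ , x , r' with lockRun u x
    ... | live y = ⊥-elim (clash r' (Tame-∥ t nil-tame) (lock-canBeLoud (Tame-⟹ u y)))
    ... | dead y = _ , y , reshape (drop stopped) (drop stopped) r'
    ... | loud b = ⊥-elim (clash-loud r' (Tame-∥ t nil-tame) b)

    -- A lock that must still be undecided has blocked time throughout, which leaves only silent
    -- steps of `D`.
    settle : ∀ {d C D X} → Fresh d C → Fresh d D → D ⟪ proc (lock d) ⟫ ⟶* X → R (C ⟪ proc (lock d) ⟫) X →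
             ∃[ D' ] (D ⟹ₑ D' × X ≡ D' ⟪ proc (lock d) ⟫)
    settle t u x r with lockRun u x
    ... | live y = _ , y , refl
    ... | dead y = ⊥-elim (unresolved t r (dead (Tame-red* u y)))
    ... | loud b = ⊥-elim (unresolved t r (loud b))

    record Locked (d : Chan) (C D : Config) : Set where
      constructor locked
      field
        tameˡ : Tame (_< d) C
        tameʳ : Tame (_< d) D
        rel   : R (C ⟪ proc (lock d) ⟫) (D ⟪ proc (lock d) ⟫)
    open Locked

    Locked-sym : ∀ {d C D} → Locked d C D → Locked d D C
    Locked-sym (locked t u r) = locked u t (symm r)

    raise : ∀ {d d' C} → d ≤ d' → Tame (_< d) C → Tame (_< d') C
    raise d≤d' = Tame-mono λ _ c<d → <-≤-trans c<d d≤d'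

    lock-legal : ∀ d → GuardedP (lock d)
    lock-legal d = tt , (λ ()) , tt

    match-τ : ∀ {d C D C'} → Locked d C D → C —[ eτ ]→ₑ C' → ∃[ D' ] (D ⟹ₑ D' × Locked d C' D')
    match-τ (locked t u r) x with redClosed r (eτ⇒red (lift-eτ (no-rcv deaf-lock) x))
    ... | _ , y , r' with settle (below⇒Fresh ≤-refl (Tame-red t (eτ⇒red x))) (below⇒Fresh ≤-refl u) y r'
    ... | _ , z , refl = _ , z , locked (Tame-red t (eτ⇒red x)) (Tame-⟹ u z) r'

    -- The new lock is present while the old one is released, so `D` cannot let time pass meanwhile.
    relock : ∀ {d d' C D} → d < d' → Locked d C D → ∃[ D' ] (D ⟹ₑ D' × Locked d' C D')
    relock {d} {d'} d<d' (locked t u r)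
      with unlock (Tame-∥ (below⇒Fresh ≤-refl t) (lock-tame d' (≢-sym (<⇒≢ d<d'))))
                  (Tame-∥ (below⇒Fresh ≤-refl u) (lock-tame d' (≢-sym (<⇒≢ d<d'))))
                  (reshape swap swap (contextual r (proc (lock d')) (lock-legal d')))
    ... | _ , y , r' with settle (below⇒Fresh (<⇒≤ d<d') t) (below⇒Fresh (<⇒≤ d<d') u) y r'
    ... | _ , z , refl = _ , z , locked (raise (<⇒≤ d<d') t) (Tame-⟹ (raise (<⇒≤ d<d') u) z) r'

    -- On the right time can pass with the lock still undecided, on the left
    -- only after it has been decided; a second delayed lock makes the
    -- passing of time observable.
    no-lag : ∀ {d C D} → Tame (_< d) C → Tame (_< d) D → ¬ R (C ⟪ proc (lock d) ⟫) (D ⟪ proc (slp (lock d)) ⟫)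
    no-lag {d} {C} {D} t u r = tick u λ
      { (_ , k) →
        let _ , x , r' = red*-closed rbc (symm (contextual r (proc (slp (lock (suc d)))) (lock-legal (suc d))))
                           -- Both delayed locks wake at this tick; then the one on `suc d` dies and
                           -- the one on `d` stays undecided.
                           (Ticks⇒⟶* (lift-tick (no-rcv deaf-slp) Sleep (lift-tick (no-rcv deaf-slp) Sleep k)) ◅◅ lock-dies ◅ ε)
        in refute (Tame-red* u (Ticks⇒⟶* k)) (delayedRun t' x) (reshape (drop stopped) ≅-refl r') }
      where
      t' : Fresh (suc d) (C ⟪ proc (lock d) ⟫)
      t' = Tame-∥ (below⇒Fresh (n≤1+n d) t) (lock-tame d (≢-sym 1+n≢n))
      refute : ∀ {D' X} → Tame (_< d) D' → DelayedRun (suc d) (C ⟪ proc (lock d) ⟫) X → ¬ R (D' ⟪ proc (lock d) ⟫) X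
      refute {D'} u' run s = cases run s
        where
        quiet : Fresh (suc d) (D' ⟪ proc (lock d) ⟫)
        quiet = Tame-∥ (below⇒Fresh (n≤1+n d) u') (lock-tame d (≢-sym 1+n≢n))
        cases : ∀ {X} → DelayedRun (suc d) (C ⟪ proc (lock d) ⟫) X → ¬ R (D' ⟪ proc (lock d) ⟫) X
        -- The second lock is still delayed here; it can wake and beacon on `suc d`, which is fresh
        -- on the other side.
        cases (lag y) s = clash s quiet λ κ → tick (Tame-⟹ t' y) λ
          { (_ , k) → κ (_ , Ticks⇒⟶* (lift-tick (no-rcv deaf-slp) Sleep k) ◅◅ lock-beacons ◅ ε
                           , beacon-loud (Tame-red* (Tame-⟹ t' y) (Ticks⇒⟶* k))) }
        cases (awake k (live y)) s = clash s quiet (lock-canBeLoud (Tame-⟹ (Tame-red* t' (Ticks⇒⟶* k)) y))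
        cases (awake k (loud b)) s = clash-loud s quiet b
        -- The second lock has woken, so time has passed beside the lock on `d`, which must have
        -- been decided before.
        cases (awake (_ , y , x) (dead z)) s =
          unresolved (below⇒Fresh ≤-refl u') (reshape ≅-refl (drop stopped) s)
            (preserved resolved-red (time-resolves ft (lockRun ft (⟹⇒⟶* y)) x) z)
          where
          ft : Fresh d C
          ft = below⇒Fresh ≤-refl t

    -- A delayed lock on `suc d` is added before the lock on `d` is released; it wakes at the time
    -- step of `C` and thus demands exactly one tick of `D`.
    match-σ : ∀ {d C D C'} → Locked d C D → C —[ eσ ]→ₑ C' →
              ∃[ E ] ∃[ D' ] (Ticks D E × E ⟹ₑ D' × Locked (suc d) C' D')
    match-σ {d} {C} {D} (locked t u r) (Time s)
      with unlock (Tame-∥ (below⇒Fresh ≤-refl t) (tame wproc (lock-legal (suc d)) (lock-chans 1+n≢n)))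
                  (Tame-∥ (below⇒Fresh ≤-refl u) (tame wproc (lock-legal (suc d)) (lock-chans 1+n≢n)))
                  (reshape swap swap (contextual r (proc (slp (lock (suc d)))) (lock-legal (suc d))))
    ... | _ , y , r' with redClosed r' (red (TimePar s Sleep) rσ)
    -- The tick of `D` may fall into either of the two runs, hence they are joined.
    ... | _ , y' , r'' = cases (delayedRun (below⇒Fresh (n≤1+n d) u) (y ◅◅ y')) r''
      where
      t₁ : Tame (_< suc d) _
      t₁ = Tame-step s (raise (n≤1+n d) t)
      u₁ : Tame (_< suc d) D
      u₁ = raise (n≤1+n d) u
      cases : ∀ {X} → DelayedRun (suc d) D X → R ((σEnv (proj₁ C) , _) ⟪ proc (lock (suc d)) ⟫) X →
              ∃[ E ] ∃[ D' ] (Ticks D E × E ⟹ₑ D' × Locked (suc d) (σEnv (proj₁ C) , _) D')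
      cases (lag z) q = ⊥-elim (no-lag t₁ (Tame-⟹ u₁ z) q)
      cases (awake k (live z)) q = _ , _ , k , z , locked t₁ (Tame-⟹ (Tame-red* u₁ (Ticks⇒⟶* k)) z) q
      cases (awake k (dead z)) q =
        ⊥-elim (unresolved (below⇒Fresh ≤-refl t₁) q
          (dead (Tame-red* (below⇒Fresh ≤-refl u₁) (Ticks⇒⟶* k ◅◅ z))))
      cases (awake k (loud b)) q = ⊥-elim (unresolved (below⇒Fresh ≤-refl t₁) q (loud b))

    -- Matching of idleness, inputs and deliveries

    extend : ∀ {d C D T} → Locked d C D → Tame (_< d) (proj₁ C , T) → Tame (_< d) (proj₁ D , T) →
             Locked d (C ⟪ T ⟫) (D ⟪ T ⟫)
    extend {T = T} (locked t u r) t' u' =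
      locked (Tame-∥ t t') (Tame-∥ u u') (reshape swap swap (contextual r T (legal t')))

    retract : ∀ {d C D I J} → Inert I → Inert J → Locked d (C ⟪ I ⟫) (D ⟪ J ⟫) → Locked d C D
    retract i j (locked t u r) =
      locked (Tame-∥ˡ t) (Tame-∥ˡ u) (reshape (≅-trans swap (drop i)) (≅-trans swap (drop j)) r)

    gate-tame : ∀ {A : Chan → Set} {Γ b P Q e} → Tame A (Γ , proc P) → Tame A (Γ , proc Q) → A e →
                Tame A (Γ , proc (gate b P Q e))
    gate-tame p q a = tame wproc ((legal p , legal q) , (λ ()) , tt) ((chans p , chans q) , a , tt)

    beacon-tame : ∀ {A : Chan → Set} {Γ} e → A e → Tame A (Γ , proc (beacon e))
    beacon-tame e a = tame wproc ((λ ()) , tt) (a , tt)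

    sleeps-tame : ∀ {A Γ} k → Tame A (Γ , proc (sleeps k nil))
    sleeps-tame k = tame wproc (GuardedP-sleeps k tt) (ChP-sleeps k tt)

    -- The gate opens towards the beacon exactly on the side where c is exposed.
    idle≁exposed : ∀ {d C D c} → Fresh d C → Fresh d D → Locked (suc d) C D →
                   Idle (proj₁ C) c → ¬ Exposed (proj₁ D) c
    idle≁exposed {d} {C} {D} {c} t u l i x =
      -- On the left the gate takes its `nil` branch, after which no beacon on `d` is possible.
      let _ , y , l' = match-τ (extend l T T) (TauExt (TauParR (SumL sτ (Else (<-irrefl (sym i))))))
      in refute (gateRun u y) (rel l')
      where
      T : ∀ {Γ} → Tame (_< suc d) (Γ , proc (gate (expb c) (beacon d) nil d))
      T = gate-tame (beacon-tame d ≤-refl) nil-tame ≤-refl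
      quiet : Fresh d (C ⟪ proc (slp nil) ⟫ ⟪ proc (lock (suc d)) ⟫)
      quiet = Tame-∥ (Tame-∥ t (sleeps-tame 1)) (lock-tame (suc d) 1+n≢n)
      refute : ∀ {X} → GateRun (expb c) (beacon d) nil d D X →
               ¬ R (C ⟪ proc (slp nil) ⟫ ⟪ proc (lock (suc d)) ⟫) (X ⟪ proc (lock (suc d)) ⟫)
      refute (closed y) r = clash r quiet (gate-canBeLoud 1+n≢n (Tame-⟹ u y))
      refute (true y _ z) r = clash r quiet (slp-canBeLoud (Tame-⟹ u (y ◅◅ z)))
      -- Silent steps do not end transmissions, so `c` is still exposed when the gate is evaluated.
      refute (false y n z) r = n (⟹-⊑ y c x)
      refute (loud b) r = clash r quiet (loud-canBeLoud 1+n≢n b)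

    idle-transfer : ∀ {d C D c} → Locked d C D → Idle (proj₁ C) c → Idle (proj₁ D) c
    idle-transfer {D = D} {c} l i with proj₁ (proj₁ D c) in eq
    ... | zero = refl
    -- Raising the lock by one frees `d` for the test; `c` stays exposed during the silent steps
    -- that this costs.
    ... | suc n = let _ , x , l' = relock ≤-refl l in
      ⊥-elim (idle≁exposed (below⇒Fresh ≤-refl (tameˡ l)) (Tame-⟹ (below⇒Fresh ≤-refl (tameʳ l)) x) l' i
        (⟹-⊑ x c (subst (1 ≤_) (sym eq) (s≤s z≤n))))

    Matched : ELabel → Config → Config → Set
    Matched α C' D = ∃[ D' ] (WeakHat α D D' × ∃[ d ] Locked d C' D')

    -- The left shot has been fired and `e` is fresh there, which rules out a right side that can
    -- still beacon; a fired shot yields the input.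
    received : ∀ {e c v C D X} → Fresh e C → Fresh e D → ShotRun c v e D X →
               Locked (suc e) (C ⟪ proc (sleeps (δ v) nil) ⟫) X → Matched (e? c v) C D
    received {e} {c} {v} {C} {D} t u run l = cases run l
      where
      quiet : Fresh e (C ⟪ proc (sleeps (δ v) nil) ⟫ ⟪ proc (lock (suc e)) ⟫)
      quiet = Tame-∥ (Tame-∥ t (sleeps-tame (δ v))) (lock-tame (suc e) 1+n≢n)
      cases : ∀ {X} → ShotRun c v e D X → Locked (suc e) (C ⟪ proc (sleeps (δ v) nil) ⟫) X → Matched (e? c v) C D
      cases (unfired z) l = ⊥-elim (clash (rel l) quiet (shot-canBeLoud 1+n≢n (Tame-⟹ u z)))
      cases (fired z i z') l = _ , (_ , _ , z , i , z') , _ , retract (inert-sleeps (δ v)) (inert-sleeps (δ v)) l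
      cases (loud b) l = ⊥-elim (clash (rel l) quiet (loud-canBeLoud 1+n≢n b))

    match-input : ∀ {d C D c v C'} → Locked d C D → C —[ e? c v ]→ₑ C' → Matched (e? c v) C' D
    match-input {d} {c = c} {v} l (Input s) =
      let _ , x , l₁ = relock (s≤s d≤e) l
          _ , y , l₂ = match-τ (extend l₁ T T) (Shh (SyncR s (SumL s! Snd)))
          u = Tame-⟹ (below⇒Fresh d≤e (tameʳ l)) x
          _ , (_ , _ , z , i , z') , l₃ = received (Tame-step s (below⇒Fresh d≤e (tameˡ l))) u (shotRun u y) l₂
      in _ , (_ , _ , x ◅◅ z , i , z') , l₃
      where
      e : Chan
      -- Large enough for `e` to be fresh and for `c`, which the shot uses, to lie below the lock on
      -- `suc e`.
      e = suc (d ⊔ c)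
      d≤e : d ≤ e
      d≤e = ≤-trans (m≤m⊔n d c) (n≤1+n _)
      T : ∀ {Γ} → Tame (_< suc e) (Γ , proc (shot c v e))
      T = tame wproc (tt , (λ ()) , tt) ((s≤s (≤-trans (m≤n⊔m d c) (n≤1+n _)) , tt) , ≤-refl , tt)

    exposed-transfer : ∀ {d C D c} → Locked d C D → Exposed (proj₁ C) c → Exposed (proj₁ D) c
    exposed-transfer {D = D} {c} l x with proj₁ (proj₁ D c) in eq
    ... | zero = ⊥-elim (<-irrefl (sym (idle-transfer (Locked-sym l) eq)) x)
    ... | suc n = s≤s z≤n

    asleep-fresh : ∀ {d C} → Fresh d C → Fresh d (C ⟪ proc (slp nil) ⟫ ⟪ proc (lock (suc (suc d))) ⟫)
    asleep-fresh {d} t = Tame-∥ (Tame-∥ t (sleeps-tame 1)) (lock-tame (suc (suc d)) λ ())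

    delivered : ∀ {d c v w C D E W X} → Fresh d C → Fresh d D → D ⟹ₑ E → proj₁ E c ≡ (1 , w) →
                Step (proj₁ E) (proj₂ E) lσ W →
                GateRun (eqb (val w) (val v)) nil (beacon d) d (σEnv (proj₁ E) , W) X →
                Locked (suc (suc d)) (C ⟪ proc (slp nil) ⟫) X → Matched (eγ c v) C D
    delivered t u y q s (closed z) k =
      ⊥-elim (clash (rel k) (asleep-fresh t) (gate-canBeLoud (λ ()) (Tame-⟹ (Tame-step s (Tame-⟹ u y)) z)))
    -- The test has succeeded: `refl` identifies the received `w` with `v`.
    delivered t u y q s (true z refl z') k =
      _ , (_ , _ , y , Deliver q s , z ◅◅ z') , _ , retract (inert-sleeps 1) (inert-sleeps 1) k
    delivered t u y q s (false z _ z') k =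
      ⊥-elim (clash (rel k) (asleep-fresh t) (slp-canBeLoud (Tame-⟹ (Tame-step s (Tame-⟹ u y)) (z ◅◅ z'))))
    delivered t u y q s (loud b) k =
      ⊥-elim (clash (rel k) (asleep-fresh t) (loud-canBeLoud (λ ()) b))

    -- The body of an active receiver, as an ordinary input on an exposed channel would only obtain
    -- `err`. On receiving `w` it becomes the gate that compares `w` with `v`.
    listener : Val → Chan → Proc 1 0
    listener v e = cond (eqb (var zero) (val v)) nil (beacon e) ⊕ tau (beacon e)

    listener-tame : ∀ {d Γ c v} → Exposed Γ c → Tame (_< suc d) (Γ , act c (listener v d))
    listener-tame x = tame (wact x) ((tt , (λ ()) , tt) , (λ ()) , tt) ((tt , ≤-refl , tt) , ≤-refl , tt)

    -- The transmission on `c` is over on the left, so by transfer of idleness also on the right,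
    -- where the receiver must have finished.
    heard : ∀ {d c v C D E X} → Fresh d C → Idle (proj₁ C) c → Fresh d D → Ticks (D ⟪ act c (listener v d) ⟫) E →
            E ⟹ₑ X → Locked (suc (suc d)) (C ⟪ proc (slp nil) ⟫) X → Matched (eγ c v) C D
    heard t i u k z l with act-tick k
    ... | inj₁ x = ⊥-elim (<-irrefl (sym (idle-transfer l i)) (⟹-⊑ z _ x))
    ... | inj₂ (_ , _ , _ , y , q , s , refl) = delivered t u y q s (gateRun (Tame-step s (Tame-⟹ u y)) z) l

    match-deliver : ∀ {d C D c v C'} → Locked d C D → C —[ eγ c v ]→ₑ C' → Matched (eγ c v) C' D
    match-deliver {C = Γ , V} {c = c} {v} l (Deliver eq s) =
      -- The lock moves to `suc d`, which leaves `d` to the listener.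
      let _ , x , l₁ = relock ≤-refl l
          exposed : Exposed Γ c
          exposed = subst (1 ≤_) (cong proj₁ (sym eq)) ≤-refl
          _ , _ , k , y , l₂ = match-σ (extend l₁ (listener-tame {v = v} exposed) (listener-tame (exposed-transfer l₁ exposed)))
                                       (Time (TimePar s (EndRcv eq)))
          -- The left listener has received `v` itself, so its gate succeeds.
          _ , z , l₃ = match-τ l₂ (TauExt (TauParR (SumL sτ (Then refl))))
          _ , (_ , _ , z₁ , i , z₂) , l₄ = heard (Tame-step s (below⇒Fresh ≤-refl (tameˡ l))) (cong (λ p → proj₁ p ∸ 1) eq)
                                                 (Tame-⟹ (below⇒Fresh ≤-refl (tameʳ l)) x) k (y ◅◅ z) l₃
      in _ , (_ , _ , x ◅◅ z₁ , i , z₂) , l₄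

    -- The bisimulation

    _∼_ : Rel Config 0ℓ
    C ∼ D = ∃[ d ] Locked d C D

    match : ∀ {C D α C'} → C ∼ D → C —[ α ]→ₑ C' → ∃[ D' ] (WeakHat α D D' × C' ∼ D')
    match {α = e? c v} (_ , l) x = match-input l x
    match {α = eσ} (_ , l) x with match-σ l x
    ... | _ , _ , (_ , y , z) , y' , l' = _ , (_ , _ , y , z , y') , _ , l'
    match {α = eτ} (_ , l) x with match-τ l x
    ... | _ , y , l' = _ , y , _ , l'
    match {α = eγ c v} (_ , l) x = match-deliver l x
    match {α = eι c} (_ , l) (IdleE i) = _ , (_ , _ , ε , IdleE (idle-transfer l i) , ε) , _ , l

    ∼-isBisimulation : IsBisimulation _∼_
    ∼-isBisimulation = match , λ
      { (_ , l) x → let _ , y , _ , l' = match (_ , Locked-sym l) x in _ , y , _ , Locked-sym l' }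

    related : ∀ {C D} → Legal C → Legal D → WellFormed C → WellFormed D → R₀ C D → C ∼ D
    -- A common bound for both systems makes the lock channel fresh on both sides.
    related {_ , V} {_ , W} g h w w' r with boundS (V ∥ W)
    ... | d , b , b' = d , locked (tame w g b) (tame w' h b')
                             (contextual (upTo ≅-refl ≅-refl r) (proc (lock d)) (lock-legal d))

mainTheorem2 : (S : Sig) → let open CCCP S in
    (C₁ C₂ : Config) → Legal C₁ → Legal C₂ →
    WellFormed C₁ → WellFormed C₂ → C₁ ≃ C₂ → C₁ ≈ C₂
mainTheorem2 S C₁ C₂ g₁ g₂ w₁ w₂ (R , rbc , r) = _∼_ , ∼-isBisimulation , related g₁ g₂ w₁ w₂ r
  where open Completeness.Matching S R rbc
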